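{- Let $k,q,p\ge 3$ be integers with $q\ge p$, and let $C_k=\frac{1}{k+1}\binom{2k}{k}$ be the $k$-th Catalan number. There exist $c\ge 1$ and $t_0$ such that for all integers $t>t_0$: (a) if $p\le C_k-2$, then $r_{k+1}(t^c;q,p)>2^{r_k(t;q,p)-1}$; (b) if $p\le C_k$, then $r_{k+1}(t^c;2q+p,p)>2^{r_k(t;q,p)-1}$; (c) if $p\le k!$, then $r_{2k}(t^c;qp,p)>2^{r_k(t;q,p)-1}$.
   Context: $K_n^{(k)}$ is the complete $k$-uniform hypergraph on $n$ vertices. For integers $q\ge p$, $r_k(t;q,p)$ is the smallest integer $n$ such that in every colouring of the edges of $K_n^{(k)}$ with $q$ colours there is a set of $t$ vertices such that the $k$-edges contained in it receive fewer than $p$ distinct colours in total. For a real number $x$ that is not an integer, $r_k(x;q,p)$ is understood as $r_k(\lceil x\rceil;q,p)$. -}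

module Defs where

open import Data.Nat.Base using (ℕ; suc; _*_; _^_; _<_; _≤_; _/_; NonZero)
open import Data.Nat.Combinatorics using (_C_)
open import Data.Integer.Base using (+_)
open import Data.Rational.Base as ℚ using (ℚ)
open import Data.Fin.Base using (Fin)
open import Data.Fin.Subset using (Subset; ∣_∣; _∈_; _⊆_)
open import Data.Product.Base using (Σ; ∃; ∃-syntax; _×_; proj₁)
open import Data.Sum.Base using (_⊎_)
open import Function.Bundles using (_⇔_)
open import Relation.Binary.PropositionalEquality.Core using (_≡_)
open import Relation.Nullary.Negation.Core using (¬_)

catalan : ℕ → ℕ
catalan k = ((2 * k) C k) / suc k

IsLeast : (ℕ → Set) → ℕ → Set
IsLeast P n = P n × (∀ m → m < n → ¬ P m)

-- Dedekind reals: `lower r` means r < x and `upper r` means x < r.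

record ℝ : Set₁ where
  field
    lower upper     : ℚ → Set
    lower-inhabited : ∃ lower
    upper-inhabited : ∃ upper
    lower-rounded   : ∀ r → lower r ⇔ (∃[ s ] r ℚ.< s × lower s)
    upper-rounded   : ∀ r → upper r ⇔ (∃[ s ] s ℚ.< r × upper s)
    disjoint        : ∀ r → ¬ (lower r × upper r)
    located         : ∀ r s → r ℚ.< s → lower r ⊎ upper s

infix 4 _≤ℝ_

_≤ℝ_ : ℚ → ℝ → Set
r ≤ℝ x = ¬ ℝ.upper x r

-- The inequality t ^ c ≤ m, for t ≥ 1 and c ≥ 0: the real power t ^ c is the
-- supremum of the powers t ^ (a / b) over the rationals 0 ≤ a / b ≤ c, and
-- t ^ (a / b) ≤ m means t ^ a ≤ m ^ b.

PowerAtMost : ℕ → ℝ → ℕ → Set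
PowerAtMost t c m =
  ∀ (a b : ℕ) .{{_ : NonZero b}} → (+ a ℚ./ b) ≤ℝ c → t ^ a ≤ m ^ b

-- m = ⌈ t ^ c ⌉
IsCeilPower : ℕ → ℝ → ℕ → Set
IsCeilPower t c = IsLeast (PowerAtMost t c)

Edge : ℕ → ℕ → Set
Edge k n = Σ (Subset n) λ e → ∣ e ∣ ≡ k

Colouring : ℕ → ℕ → ℕ → Set
Colouring k n q = Edge k n → Fin q

IsColourSet : ∀ {k n q} → Colouring k n q → Subset n → Subset q → Set
IsColourSet χ S D = ∀ i → i ∈ D ⇔ (∃[ e ] proj₁ e ⊆ S × χ e ≡ i)

FewColours : ∀ {k n q} → ℕ → Colouring k n q → Subset n → Set
FewColours p χ S = ∃[ D ] IsColourSet χ S D × ∣ D ∣ < p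

Unavoidable : (k t q p n : ℕ) → Set
Unavoidable k t q p n =
  ∀ (χ : Colouring k n q) → ∃[ S ] ∣ S ∣ ≡ t × FewColours p χ S

-- n = r_k(t; q, p).  A relation rather than a function, so that no proof of
-- Ramsey's theorem (which gives existence of n) is needed to state it.
IsRamsey : (k t q p n : ℕ) → Set
IsRamsey k t q p = IsLeast (Unavoidable k t q p)

-- n = r_k(t ^ c; q, p), where the real number t ^ c is rounded up.
IsRamseyPower : (k t : ℕ) (c : ℝ) (q p n : ℕ) → Set
IsRamseyPower k t c q p n = ∃[ s ] IsCeilPower t c s × IsRamsey k s q p n

{-# OPTIONS --safe #-}
module Submission where

-- Step up from χ on [n] to {0,1}^n, viewing a set of strings as a binary tree whose
-- branchings sit at depths in [n].  In (a) and (b) an edge with k + 1 leaves spans a binary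
-- tree with k branchings: the two combs are coloured by χ of their branching depths (in (b)
-- with separate palettes), the other C_k - 2 shapes by the shape.  A set of more than
-- (2t)^h strings contains either a comb with t branchings, hence a t-set for χ, or a
-- complete binary tree of height h, hence all shapes.
-- In (c) an edge v_1 < ... < v_2k is coloured by χ and the Lehmer code of the depths at
-- which v_1, v_2 separate, v_3, v_4 separate, and so on.  If at least 2t depths occur in a
-- large set, then t of them are separations of disjoint consecutive pairs, hence a t-set
-- for χ.  Otherwise the set order-shatters (as in the Sauer-Shelah lemma) 2k depths, and
-- then every order of k depths is realised.

open import Data.Bool.Base using (Bool; true; false; _∧_; _∨_) renaming (_≤_ to _≤ᵇ_; f≤t to false≤true; b≤b to bool≤refl)
open import Data.Empty using (⊥-elim)
open import Data.Fin.Base using (Fin; zero; suc; toℕ; combine; remQuot; splitAt; _↑ˡ_; _↑ʳ_; inject≤)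
import Data.Fin.Properties as Fin
open import Data.Fin.Subset using (Subset; ∣_∣; _∈_; _⊆_; _-_; ⊤; ⊥; _∪_)
open import Data.Fin.Subset.Properties
import Data.Integer.Base as ℤ
open import Data.List.Base using (List; []; _∷_; _++_; length; lookup; map; drop; filter)
open import Data.List.Properties using (length-++; length-map; map-∘; ++-identityʳ; filter-all)
open import Data.List.Membership.DecPropositional using () renaming (_∈?_ to ∈ˡ?)
open import Data.List.Membership.Propositional using () renaming (_∈_ to _∈ˡ_)
open import Data.List.Membership.Propositional.Properties using (∈-map⁺; ∈-map⁻; ∈-lookup)
open import Data.List.Relation.Binary.Disjoint.Propositional using (Disjoint)
open import Data.List.Relation.Binary.Sublist.Propositional using ([]; _∷_; _∷ʳ_; minimum) renaming (_⊆_ to _⊆ˡ_; ⊆-trans to ⊆ˡ-trans; ⊆-refl to ⊆ˡ-refl)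
import Data.List.Relation.Binary.Sublist.Propositional.Properties as Sublist
open import Data.List.Relation.Unary.All as All using (All; []; _∷_)
import Data.List.Relation.Unary.All.Properties as All
open import Data.List.Relation.Unary.AllPairs using ([]; _∷_)
open import Data.List.Relation.Unary.Any using (here; there)
open import Data.List.Relation.Unary.Any.Properties using (¬Any[])
open import Data.List.Relation.Unary.Unique.Propositional using (Unique)
import Data.List.Relation.Unary.Unique.Propositional.Properties as Unique
open import Data.Maybe.Base using (Maybe; just; nothing; is-just; maybe′)
open import Data.Nat.Base using (ℕ; zero; suc; pred; _+_; _*_; _∸_; _/_; _%_; _^_; _<_; _≤_; z≤n; s≤s; s≤s⁻¹; _!; >-nonZero)
open import Data.Nat.Combinatorics using (_C_; nCk≡nC[n∸k]; nCk+nC[k+1]≡[n+1]C[k+1]; nC1≡n)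
open import Data.Nat.DivMod using (m*n/n≡m; m%n<n; m≡m%n+[m/n]*n; m<n*o⇒m/o<n)
open import Data.Nat.Properties
open import Data.Nat.Tactic.RingSolver using (solve-∀)
open import Data.Product.Base using (Σ; ∃-syntax; _×_; _,_; proj₁; proj₂)
open import Data.Rational.Base as ℚ using (ℚ; 1ℚ)
import Data.Rational.Properties as ℚ
import Data.Rational.Unnormalised.Base as ℚᵘ
import Data.Rational.Unnormalised.Properties as ℚᵘ
open import Data.Sum.Base as Sum using (_⊎_; inj₁; inj₂; [_,_]′)
open import Data.Vec.Base as Vec using (Vec; []; _∷_; here; there)
import Data.Vec.Properties as Vec
open import Data.Vec.Relation.Binary.Pointwise.Inductive using (Pointwise; []; _∷_; ++⁺)
open import Function.Base using (id; _∘_)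
open import Function.Bundles using (mk⇔; Equivalence)
open import Relation.Binary.Definitions using (DecidableEquality)
open import Relation.Binary.PropositionalEquality
open import Relation.Nullary using (Dec; yes; no; ¬_; ¬?; does; _×-dec_)
open import Relation.Nullary.Decidable using (dec-true; map′)
open import Defs

-- Counting in finite subsets

-- Induction on `A`: the partner of its first element is deleted from `B`, and injectivity of `R`
-- lets the later elements keep theirs.
relation-≤ : ∀ {m n} (A : Subset m) (B : Subset n) (R : Fin m → Fin n → Set) →
  (∀ {i i′ j} → R i j → R i′ j → i ≡ i′) →
  (∀ {i} → i ∈ A → ∃[ j ] j ∈ B × R i j) → ∣ A ∣ ≤ ∣ B ∣
relation-≤ [] B R inj total = z≤n
relation-≤ (false ∷ A) B R inj total =
  relation-≤ A B (λ i → R (suc i)) (λ r r′ → Fin.suc-injective (inj r r′)) (λ i∈A → total (there i∈A))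
relation-≤ {suc m} (true ∷ A) B R inj total with total here
... | j , j∈B , r = ≤-trans (s≤s rest) (x∈p⇒∣p-x∣<∣p∣ j∈B)
  where
  rest : ∣ A ∣ ≤ ∣ B - j ∣
  rest = relation-≤ A (B - j) (λ i → R (suc i)) (λ r r′ → Fin.suc-injective (inj r r′)) λ {i} i∈A →
    let j′ , j′∈B , r′ = total (there i∈A)
    in j′ , x∈p∧x≢y⇒x∈p-y j′∈B (λ where refl → 0≢suc (inj r r′)) , r′
    where
    0≢suc : ∀ {i : Fin m} → zero ≢ suc i
    0≢suc ()

image-≤ : ∀ {m n} (A : Subset m) (B : Subset n) (f : Fin n → Fin m) →
  (∀ {i} → i ∈ A → ∃[ j ] j ∈ B × f j ≡ i) → ∣ A ∣ ≤ ∣ B ∣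
image-≤ A B f = relation-≤ A B (λ i j → f j ≡ i) (λ e e′ → trans (sym e) e′)

-- Every contradiction with `∣ D ∣ < p` comes from here: the colours in `D` are mapped onto `p`
-- classes.
surjective-≤ : ∀ {m n} (B : Subset n) (f : Fin n → Fin m) →
  (∀ i → ∃[ j ] j ∈ B × f j ≡ i) → m ≤ ∣ B ∣
surjective-≤ {m} B f onto = subst (_≤ ∣ B ∣) (∣⊤∣≡n m) (image-≤ ⊤ B f (λ {i} _ → onto i))

subset-of-size : ∀ {n} t (A : Subset n) → t ≤ ∣ A ∣ → ∃[ B ] B ⊆ A × ∣ B ∣ ≡ t
subset-of-size {n} zero A _ = ⊥ , ⊥⊆ , ∣⊥∣≡0 n
subset-of-size (suc t) (true ∷ A) (s≤s t≤) with subset-of-size t A t≤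
... | B , B⊆A , refl = true ∷ B , s⊆s B⊆A , refl
subset-of-size (suc t) (false ∷ A) t≤ with subset-of-size (suc t) A t≤
... | B , B⊆A , eq = false ∷ B , s⊆s B⊆A , eq

union-≤ : ∀ {n} (A B : Subset n) → ∣ A ∪ B ∣ ≤ ∣ A ∣ + ∣ B ∣
union-≤ [] [] = z≤n
union-≤ (true ∷ A) (true ∷ B) =
  s≤s (≤-trans (union-≤ A B) (+-monoʳ-≤ ∣ A ∣ (n≤1+n ∣ B ∣)))
union-≤ (true ∷ A) (false ∷ B) = s≤s (union-≤ A B)
union-≤ (false ∷ A) (true ∷ B) = subst (suc ∣ A ∪ B ∣ ≤_) (sym (+-suc ∣ A ∣ ∣ B ∣)) (s≤s (union-≤ A B))
union-≤ (false ∷ A) (false ∷ B) = union-≤ A B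

comprehension : ∀ {n} {P : Fin n → Set} → (∀ i → Dec (P i)) → Subset n
comprehension P? = Vec.tabulate (λ i → does (P? i))

∈-comprehension⁺ : ∀ {n} {P : Fin n → Set} (P? : ∀ i → Dec (P i)) {i} → P i → i ∈ comprehension P?
∈-comprehension⁺ P? {i} p = Vec.lookup⇒[]= i _ (trans (Vec.lookup∘tabulate _ i) (dec-true (P? i) p))

∈-comprehension⁻ : ∀ {n} {P : Fin n → Set} (P? : ∀ i → Dec (P i)) {i} → i ∈ comprehension P? → P i
∈-comprehension⁻ P? {i} i∈ with P? i | trans (sym (Vec.lookup∘tabulate (λ j → does (P? j)) i)) (Vec.[]=⇒lookup i∈)
... | yes p | _ = p

module _ {k n q : ℕ} (χ : Colouring k n q) (S : Subset n) where

  Occurs : Fin q → Set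
  Occurs i = ∃[ e ] proj₁ e ⊆ S × χ e ≡ i

  -- `FewColours` asks for the exact set of colours as a `Subset`, so the occurrence of a colour is
  -- decided by a search through all vertex sets.
  occurs? : ∀ i → Dec (Occurs i)
  occurs? i with anySubset? coloured?
    where
    Coloured : Subset n → Set
    Coloured X = Σ (∣ X ∣ ≡ k) λ size → X ⊆ S × χ (X , size) ≡ i
    coloured? : ∀ X → Dec (Coloured X)
    coloured? X with ∣ X ∣ ≟ k
    ... | no size≢ = no (λ c → size≢ (proj₁ c))
    ... | yes size with X ⊆? S ×-dec χ (X , size) Fin.≟ i
    ...   | yes c = yes (size , c)
    ...   | no ¬c = no λ (size′ , X⊆S , eq) →
      ¬c (X⊆S , trans (cong (λ z → χ (X , z)) (≡-irrelevant size size′)) eq)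
  ... | yes (X , size , X⊆S , eq) = yes ((X , size) , X⊆S , eq)
  ... | no ¬c = no λ ((X , size) , X⊆S , eq) → ¬c (X , size , X⊆S , eq)

  -- Transfers a bound back from a stepped-up colouring: `D` holds the colours seen there, and `f`
  -- recovers the colours of `χ` from them.
  few-colours : ∀ {Q p} (D : Subset Q) (f : Fin Q → Fin q) → ∣ D ∣ < p →
    (∀ e → proj₁ e ⊆ S → ∃[ j ] j ∈ D × f j ≡ χ e) → FewColours p χ S
  few-colours D f D<p covers =
    comprehension occurs? ,
    (λ i → mk⇔ (∈-comprehension⁻ occurs?) (∈-comprehension⁺ occurs?)) ,
    ≤-<-trans (image-≤ (comprehension occurs?) D f image) D<p
    where
    image : ∀ {i} → i ∈ comprehension occurs? → ∃[ j ] j ∈ D × f j ≡ i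
    image i∈ with ∈-comprehension⁻ occurs? i∈
    ... | e , e⊆S , refl = covers e e⊆S

-- Sets of binary strings as trees

-- A set of binary strings of length n, organised by its leading bits.
data Tree : ℕ → Set where
  tip  : Bool → Tree 0
  fork : ∀ {n} → Tree n → Tree n → Tree (suc n)

size : ∀ {n} → Tree n → ℕ
size (tip true) = 1
size (tip false) = 0
size (fork l r) = size l + size r

infix 4 _⊑_
-- Inclusion of sets of strings of the same length, not passage to a rooted subtree.
data _⊑_ : ∀ {n} → Tree n → Tree n → Set where
  tip  : ∀ {b c} → b ≤ᵇ c → tip b ⊑ tip c
  fork : ∀ {n} {l l′ r r′ : Tree n} → l ⊑ l′ → r ⊑ r′ → fork l r ⊑ fork l′ r′

∅ : ∀ {n} → Tree n
∅ {zero} = tip false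
∅ {suc n} = fork ∅ ∅

∅⊑ : ∀ {n} {T : Tree n} → ∅ ⊑ T
∅⊑ {T = tip false} = tip bool≤refl
∅⊑ {T = tip true} = tip false≤true
∅⊑ {T = fork l r} = fork ∅⊑ ∅⊑

-- Powers of two in a form that `Vec.take` and `Vec.drop` can halve by definition.
pow : ℕ → ℕ
pow zero = 1
pow (suc n) = pow n + pow n

pow≡2^ : ∀ n → pow n ≡ 2 ^ n
pow≡2^ zero = refl
pow≡2^ (suc n) = cong₂ _+_ (pow≡2^ n) (trans (pow≡2^ n) (sym (+-identityʳ _)))

toTree : ∀ n → Subset (pow n) → Tree n
toTree zero (b ∷ []) = tip b
toTree (suc n) X = fork (toTree n (Vec.take (pow n) X)) (toTree n (Vec.drop (pow n) X))

∣++∣ : ∀ {m n} (X : Subset m) (Y : Subset n) → ∣ X Vec.++ Y ∣ ≡ ∣ X ∣ + ∣ Y ∣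
∣++∣ [] Y = refl
∣++∣ (true ∷ X) Y = cong suc (∣++∣ X Y)
∣++∣ (false ∷ X) Y = ∣++∣ X Y

size-toTree : ∀ n X → size (toTree n X) ≡ ∣ X ∣
size-toTree zero (true ∷ []) = refl
size-toTree zero (false ∷ []) = refl
size-toTree (suc n) X = begin
  size (toTree n (Vec.take (pow n) X)) + size (toTree n (Vec.drop (pow n) X))
    ≡⟨ cong₂ _+_ (size-toTree n _) (size-toTree n _) ⟩
  ∣ Vec.take (pow n) X ∣ + ∣ Vec.drop (pow n) X ∣
    ≡⟨ ∣++∣ (Vec.take (pow n) X) (Vec.drop (pow n) X) ⟨
  ∣ Vec.take (pow n) X Vec.++ Vec.drop (pow n) X ∣
    ≡⟨ cong ∣_∣ (Vec.take++drop≡id (pow n) X) ⟩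
  ∣ X ∣ ∎
  where open ≡-Reasoning

infix 4 _≼_
_≼_ : ∀ {n} → Subset n → Subset n → Set
_≼_ = Pointwise _≤ᵇ_

≼⇒⊆ : ∀ {n} {X Y : Subset n} → X ≼ Y → X ⊆ Y
≼⇒⊆ (bool≤refl ∷ ps) here = here
≼⇒⊆ (_ ∷ ps) (there i) = there (≼⇒⊆ ps i)

take-++ : ∀ {m n} (X : Subset m) (Y : Subset n) → Vec.take m (X Vec.++ Y) ≡ X
take-++ [] Y = refl
take-++ (x ∷ X) Y = cong (x ∷_) (take-++ X Y)

drop-++ : ∀ {m n} (X : Subset m) (Y : Subset n) → Vec.drop m (X Vec.++ Y) ≡ Y
drop-++ [] Y = refl
drop-++ (x ∷ X) Y = drop-++ X Y

toTree-down-closed : ∀ n X {T} → T ⊑ toTree n X → ∃[ Y ] Y ≼ X × toTree n Y ≡ T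
toTree-down-closed zero (b ∷ []) {tip c} (tip c≤b) = c ∷ [] , c≤b ∷ [] , refl
toTree-down-closed (suc n) X (fork l⊑ r⊑)
  with toTree-down-closed n _ l⊑ | toTree-down-closed n _ r⊑
... | Y , Y≼ , refl | Z , Z≼ , refl =
  Y Vec.++ Z ,
  subst (Y Vec.++ Z ≼_) (Vec.take++drop≡id (pow n) X) (++⁺ Y≼ Z≼) ,
  cong₂ fork (cong (toTree n) (take-++ Y Z)) (cong (toTree n) (drop-++ Y Z))

pad : ∀ {m n} → m ≤ n → Subset m → Subset n
pad z≤n [] = ⊥
pad (s≤s m≤n) (b ∷ X) = b ∷ pad m≤n X

∣pad∣ : ∀ {m n} (m≤n : m ≤ n) X → ∣ pad m≤n X ∣ ≡ ∣ X ∣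
∣pad∣ {n = n} z≤n [] = ∣⊥∣≡0 n
∣pad∣ (s≤s m≤n) (true ∷ X) = cong suc (∣pad∣ m≤n X)
∣pad∣ (s≤s m≤n) (false ∷ X) = ∣pad∣ m≤n X

≼⊥ : ∀ {n} {Y : Subset n} → Y ≼ ⊥ → Y ≡ ⊥
≼⊥ {zero} [] = refl
≼⊥ {suc n} (bool≤refl ∷ Y≼) = cong (false ∷_) (≼⊥ Y≼)

pad-down-closed : ∀ {m n} (m≤n : m ≤ n) X {Y} → Y ≼ pad m≤n X → ∃[ Z ] Z ≼ X × pad m≤n Z ≡ Y
pad-down-closed z≤n [] Y≼ = [] , [] , sym (≼⊥ Y≼)
pad-down-closed (s≤s m≤n) (b ∷ X) {c ∷ Y} (c≤b ∷ Y≼) with pad-down-closed m≤n X Y≼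
... | Z , Z≼ , refl = c ∷ Z , c≤b ∷ Z≼ , refl

-- `Unavoidable` for a single colouring of the sets of `K` strings. `D` need only contain the
-- colours that occur.
TreeUnavoidable : ∀ {n Q} (K s p : ℕ) → (Tree n → Fin Q) → Set
TreeUnavoidable {n} {Q} K s p colour =
  ∃[ T ] size T ≡ s × Σ (Subset Q) λ D → ∣ D ∣ < p × (∀ {T′} → T′ ⊑ T → size T′ ≡ K → colour T′ ∈ D)

-- The `m` vertices serve as the first `m` strings of length `n`, so each colouring of trees
-- restricts to a colouring of edges.
tree-unavoidable : ∀ {K s p m n Q} (colour : Tree n → Fin Q) → m ≤ pow n →
  Unavoidable K s Q p m → TreeUnavoidable K s p colour
tree-unavoidable {K} {m = m} {n} colour m≤pow unavoidable = go (unavoidable (λ e → colour (tree (proj₁ e))))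
  where
  tree : Subset m → Tree n
  tree X = toTree n (pad m≤pow X)
  size-tree : ∀ X → size (tree X) ≡ ∣ X ∣
  size-tree X = trans (size-toTree n _) (∣pad∣ m≤pow X)
  go : ∃[ S ] ∣ S ∣ ≡ _ × FewColours _ (λ e → colour (tree (proj₁ e))) S → TreeUnavoidable K _ _ colour
  go (S , ∣S∣≡s , D , isColourSet , ∣D∣<p) =
    tree S , trans (size-tree S) ∣S∣≡s , D , ∣D∣<p , member
    where
    member : ∀ {T} → T ⊑ tree S → size T ≡ K → colour T ∈ D
    member T⊑ size≡K with toTree-down-closed n _ T⊑
    ... | Y , Y≼ , refl with pad-down-closed m≤pow S Y≼
    ...   | Z , Z≼ , refl = Equivalence.from (isColourSet _)
      ((Z , trans (sym (size-tree Z)) size≡K) , ≼⇒⊆ Z≼ , refl)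

-- Combs and shapes

data Shape : Set where
  leaf : Shape
  node : Shape → Shape → Shape

nodes : Shape → ℕ
nodes leaf = 0
nodes (node σ τ) = suc (nodes σ + nodes τ)

-- A fork with only one nonempty side disappears, so unary chains are contracted.
graft : Maybe Shape → Maybe Shape → Maybe Shape
graft nothing  y        = y
graft (just x) nothing  = just x
graft (just x) (just y) = just (node x y)

shape : ∀ {n} → Tree n → Maybe Shape
shape (tip true) = just leaf
shape (tip false) = nothing
shape (fork l r) = graft (shape l) (shape r)

nonempty : ∀ {n} → Tree n → Bool
nonempty T = is-just (shape T)

-- Depth 0 is the leading bit.
levels : ∀ {n} → Tree n → Subset n
levels (tip b) = []
levels (fork l r) = (nonempty l ∧ nonempty r) ∷ (levels l ∪ levels r)

maybe-size : Maybe Shape → ℕ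
maybe-size nothing = 0
maybe-size (just σ) = suc (nodes σ)

-- Contracting unary chains keeps the leaves, and a binary tree has one leaf more than it has nodes.
size-shape : ∀ {n} (T : Tree n) → size T ≡ maybe-size (shape T)
size-shape (tip true) = refl
size-shape (tip false) = refl
size-shape (fork l r) = trans (cong₂ _+_ (size-shape l) (size-shape r)) (graft-size (shape l) (shape r))
  where
  graft-size : ∀ x y → maybe-size x + maybe-size y ≡ maybe-size (graft x y)
  graft-size nothing y = refl
  graft-size (just σ) nothing = +-identityʳ _
  graft-size (just σ) (just τ) = cong suc (+-suc (nodes σ) (nodes τ))

size-of-shape : ∀ {n} (T : Tree n) {σ} → shape T ≡ just σ → size T ≡ suc (nodes σ)
size-of-shape T eq = trans (size-shape T) (cong maybe-size eq)

shape-∅ : ∀ {n} → shape (∅ {n}) ≡ nothing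
shape-∅ {zero} = refl
shape-∅ {suc n} rewrite shape-∅ {n} = refl

levels-∅ : ∀ {n} → levels (∅ {n}) ≡ ⊥
levels-∅ {zero} = refl
levels-∅ {suc n} rewrite shape-∅ {n} | levels-∅ {n} = cong (false ∷_) (∪-identityˡ ⊥)

graft-nothingʳ : ∀ x → graft x nothing ≡ x
graft-nothingʳ nothing = refl
graft-nothingʳ (just x) = refl

is-just-∧ʳ : ∀ (x : Maybe Shape) → is-just x ∧ false ≡ false
is-just-∧ʳ nothing = refl
is-just-∧ʳ (just x) = refl

shape-fork-∅ʳ : ∀ {n} (T : Tree n) → shape (fork T ∅) ≡ shape T
shape-fork-∅ʳ {n} T rewrite shape-∅ {n} = graft-nothingʳ (shape T)

shape-fork-∅ˡ : ∀ {n} (T : Tree n) → shape (fork ∅ T) ≡ shape T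
shape-fork-∅ˡ {n} T rewrite shape-∅ {n} = refl

levels-fork-∅ʳ : ∀ {n} (T : Tree n) → levels (fork T ∅) ≡ false ∷ levels T
levels-fork-∅ʳ {n} T rewrite shape-∅ {n} | levels-∅ {n} = cong₂ _∷_ (is-just-∧ʳ (shape T)) (∪-identityʳ _)

levels-fork-∅ˡ : ∀ {n} (T : Tree n) → levels (fork ∅ T) ≡ false ∷ levels T
levels-fork-∅ˡ {n} T rewrite shape-∅ {n} | levels-∅ {n} = cong (false ∷_) (∪-identityˡ _)

-- Shape and branching depths are all that the colourings for (a) and (b) see of an edge.
Realises : ∀ {n} → Tree n → Shape → Subset n → Set
Realises T σ D = ∃[ T′ ] T′ ⊑ T × shape T′ ≡ just σ × levels T′ ≡ D

realises-left : ∀ {n} {l r : Tree n} {σ D} → Realises l σ D → Realises (fork l r) σ (false ∷ D)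
realises-left (T , T⊑ , eq , refl) =
  fork T ∅ , fork T⊑ ∅⊑ , trans (shape-fork-∅ʳ T) eq , levels-fork-∅ʳ T

realises-right : ∀ {n} {l r : Tree n} {σ D} → Realises r σ D → Realises (fork l r) σ (false ∷ D)
realises-right (T , T⊑ , eq , refl) =
  fork ∅ T , fork ∅⊑ T⊑ , trans (shape-fork-∅ˡ T) eq , levels-fork-∅ˡ T

realises-node : ∀ {n} {l r : Tree n} {σ τ D E} →
  Realises l σ D → Realises r τ E → Realises (fork l r) (node σ τ) (true ∷ (D ∪ E))
realises-node {n} {l} {r} {σ} {τ} {D} {E} (T , T⊑ , eqT , refl) (U , U⊑ , eqU , refl) =
  fork T U , fork T⊑ U⊑ , cong₂ graft eqT eqU ,
  cong (_∷ (levels T ∪ levels U)) (cong₂ (λ x y → is-just x ∧ is-just y) eqT eqU)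

sum-positive : ∀ m {n} → 0 < m + n → 0 < m ⊎ 0 < n
sum-positive zero lt = inj₂ lt
sum-positive (suc m) lt = inj₁ (s≤s z≤n)

realises-leaf : ∀ {n} (T : Tree n) → 0 < size T → Realises T leaf ⊥
realises-leaf (tip true) _ = tip true , tip bool≤refl , refl , refl
realises-leaf (fork l r) lt with sum-positive (size l) lt
... | inj₁ l>0 = realises-left (realises-leaf l l>0)
... | inj₂ r>0 = realises-right (realises-leaf r r>0)

data Side : Set where
  left right : Side

combShape : Side → ℕ → Shape
combShape s zero = leaf
combShape left (suc j) = node (combShape left j) leaf
combShape right (suc j) = node leaf (combShape right j)

nodes-comb : ∀ s j → nodes (combShape s j) ≡ j
nodes-comb s zero = refl
nodes-comb left (suc j) = cong suc (trans (+-identityʳ _) (nodes-comb left j))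
nodes-comb right (suc j) = cong suc (nodes-comb right j)

-- T has a path that leaves a nonempty subtree on the other side at the depths in D.
Comb : ∀ {n} → Side → Subset n → Tree n → Set
Comb s [] T = 0 < size T
Comb s (false ∷ D) (fork l r) = Comb s D l ⊎ Comb s D r
Comb left (true ∷ D) (fork l r) = Comb left D l × 0 < size r
Comb right (true ∷ D) (fork l r) = 0 < size l × Comb right D r

-- At a depth dropped from `D` the path continues on its side and the subtree hanging there is
-- ignored. Thus every `k`-subset of the depths of a long comb belongs to a comb.
comb-⊆ : ∀ {n} s {D E : Subset n} {T} → E ⊆ D → Comb s D T → Comb s E T
comb-⊆ s {[]} {[]} E⊆D c = c
comb-⊆ s {false ∷ D} {false ∷ E} {fork l r} E⊆D =
  Sum.map (comb-⊆ s (drop-∷-⊆ E⊆D)) (comb-⊆ s (drop-∷-⊆ E⊆D))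
comb-⊆ s {false ∷ D} {true ∷ E} E⊆D c with () ← E⊆D here
comb-⊆ left {true ∷ D} {false ∷ E} {fork l r} E⊆D (c , _) = inj₁ (comb-⊆ left (drop-∷-⊆ E⊆D) c)
comb-⊆ left {true ∷ D} {true ∷ E} {fork l r} E⊆D (c , r>0) = comb-⊆ left (drop-∷-⊆ E⊆D) c , r>0
comb-⊆ right {true ∷ D} {false ∷ E} {fork l r} E⊆D (_ , c) = inj₂ (comb-⊆ right (drop-∷-⊆ E⊆D) c)
comb-⊆ right {true ∷ D} {true ∷ E} {fork l r} E⊆D (l>0 , c) = l>0 , comb-⊆ right (drop-∷-⊆ E⊆D) c

-- One leaf is kept from each hanging subtree, and one at the end of the path.
realises-comb : ∀ {n} s (D : Subset n) (T : Tree n) → Comb s D T → Realises T (combShape s ∣ D ∣) D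
realises-comb s [] (tip b) c = realises-leaf (tip b) c
realises-comb s (false ∷ D) (fork l r) (inj₁ c) = realises-left (realises-comb s D l c)
realises-comb s (false ∷ D) (fork l r) (inj₂ c) = realises-right (realises-comb s D r c)
realises-comb left (true ∷ D) (fork l r) (c , r>0) =
  subst (Realises _ _) (cong (true ∷_) (∪-identityʳ D))
    (realises-node (realises-comb left D l c) (realises-leaf r r>0))
realises-comb right (true ∷ D) (fork l r) (l>0 , c) =
  subst (Realises _ _) (cong (true ∷_) (∪-identityˡ D))
    (realises-node (realises-leaf l l>0) (realises-comb right D r c))

HasComb : ∀ {n} → Side → ℕ → Tree n → Set
HasComb s t T = ∃[ D ] ∣ D ∣ ≡ t × Comb s D T

-- A complete binary tree of height `h` contains these shapes, since a shape with at most `h` nodes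
-- has height at most `h`.
HasShapes : ∀ {n} → ℕ → Tree n → Set
HasShapes h T = ∀ σ → nodes σ ≤ h → ∃[ D ] Realises T σ D

has-comb-left : ∀ {n} s {t} {l r : Tree n} → HasComb s t l → HasComb s t (fork l r)
has-comb-left s (D , eq , c) = false ∷ D , eq , inj₁ c

has-comb-right : ∀ {n} s {t} {l r : Tree n} → HasComb s t r → HasComb s t (fork l r)
has-comb-right s (D , eq , c) = false ∷ D , eq , inj₂ c

comb-empty : ∀ {n} s (T : Tree n) → 0 < size T → Comb s ⊥ T
comb-empty s (tip b) lt = lt
comb-empty s (fork l r) lt = Sum.map (comb-empty s l) (comb-empty s r) (sum-positive (size l) lt)

has-comb-zero : ∀ {n} s {T : Tree n} → 0 < size T → HasComb s 0 T
has-comb-zero {n} s {T} lt = ⊥ , ∣⊥∣≡0 n , comb-empty s T lt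

has-shapes-left : ∀ {n h} {l r : Tree n} → HasShapes h l → HasShapes h (fork l r)
has-shapes-left hs σ le with hs σ le
... | D , real = false ∷ D , realises-left real

has-shapes-right : ∀ {n h} {l r : Tree n} → HasShapes h r → HasShapes h (fork l r)
has-shapes-right hs σ le with hs σ le
... | D , real = false ∷ D , realises-right real

-- Removing the root of a shape with at most `suc h` nodes leaves at most `h` nodes on each side.
has-shapes-fork : ∀ {n h} {l r : Tree n} → HasShapes h l → HasShapes h r → HasShapes (suc h) (fork l r)
has-shapes-fork hl hr leaf _ = has-shapes-left hl leaf z≤n
has-shapes-fork hl hr (node σ τ) (s≤s le)
  with hl σ (≤-trans (m≤m+n _ _) le) | hr τ (≤-trans (m≤n+m _ _) le)
... | D , rσ | E , rτ = true ∷ (D ∪ E) , realises-node rσ rτ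

has-shapes-zero : ∀ {n} {T : Tree n} → 0 < size T → HasShapes 0 T
has-shapes-zero {T = T} lt leaf _ = ⊥ , realises-leaf T lt

-- Long combs or all shapes

-- The recursion behind the thresholds: beyond `suc e ^ suc h` leaves, a fork has a side with more
-- than `e ^ suc h` or two sides with more than `e ^ h`.
step-bound : ∀ e h → e ^ suc h + e ^ h ≤ suc e ^ suc h
step-bound e h = begin
  e * e ^ h + e ^ h     ≡⟨ +-comm (e * e ^ h) (e ^ h) ⟩
  suc e * e ^ h         ≤⟨ *-monoʳ-≤ (suc e) (^-monoˡ-≤ h (n≤1+n e)) ⟩
  suc e * suc e ^ h     ∎
  where open ≤-Reasoning

data Split (x y P Q : ℕ) : Set where
  firstLarge  : P < x → Split x y P Q
  secondLarge : P < y → Split x y P Q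
  bothMedium  : Q < x → Q < y → Split x y P Q

-- If neither summand exceeds `P`, each must exceed `Q` to make up the sum.
split : ∀ {x y} P Q → P + Q < x + y → Split x y P Q
split {x} {y} P Q lt with P <? x | P <? y
... | yes P<x | _ = firstLarge P<x
... | no _ | yes P<y = secondLarge P<y
... | no P≮x | no P≮y = bothMedium
  (+-cancelʳ-< P Q x (≤-trans (s≤s (≤-reflexive (+-comm Q P))) (≤-trans lt (+-monoʳ-≤ x (≮⇒≥ P≮y)))))
  (+-cancelˡ-< P Q y (≤-trans lt (+-monoˡ-≤ y (≮⇒≥ P≮x))))

ShapeOutcome : ∀ {n} → ℕ → ℕ → ℕ → Tree n → Set
ShapeOutcome a b h T = HasComb left a T ⊎ HasComb right b T ⊎ HasShapes h T

-- A tree with N leaves and no long comb is shallow up to unary chains, and a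
-- shallow tree with many leaves contains a large complete binary tree.
comb-or-shapes : ∀ {n} a b h (T : Tree n) → (a + b) ^ h < size T → ShapeOutcome a b h T
comb-or-shapes zero b h T lt = inj₁ (has-comb-zero left (≤-<-trans z≤n lt))
comb-or-shapes (suc a) zero h T lt = inj₂ (inj₁ (has-comb-zero right (≤-<-trans z≤n lt)))
comb-or-shapes (suc a) (suc b) zero T lt = inj₂ (inj₂ (has-shapes-zero (≤-<-trans z≤n lt)))
comb-or-shapes (suc a) (suc b) (suc h) (tip c) lt =
  ⊥-elim (<-irrefl refl (≤-<-trans (m^n>0 (suc a + suc b) (suc h)) (<-≤-trans lt (tip≤1 c))))
  where
  tip≤1 : ∀ c → size (tip c) ≤ 1
  tip≤1 true = ≤-refl
  tip≤1 false = z≤n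
-- A fork with an empty side is not a branching: it is passed through with `a`, `b` and `h`
-- unchanged.
comb-or-shapes (suc a) (suc b) (suc h) (fork l r) lt with size l ≟ 0 | size r ≟ 0
... | yes l≡0 | _ =
  Sum.map (has-comb-right left) (Sum.map (has-comb-right right) has-shapes-right)
    (comb-or-shapes (suc a) (suc b) (suc h) r (subst (λ z → _ < z + size r) l≡0 lt))
... | no _ | yes r≡0 =
  Sum.map (has-comb-left left) (Sum.map (has-comb-left right) has-shapes-left)
    (comb-or-shapes (suc a) (suc b) (suc h) l
      (subst (_ <_) (trans (cong (size l +_) r≡0) (+-identityʳ _)) lt))
... | no l≢0 | no r≢0 = go (split (d ^ suc h) (d ^ h) (≤-<-trans (step-bound d h) lt))
  where
  d = a + suc b
  extend-left : HasComb left a l → HasComb left (suc a) (fork l r)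
  extend-left (D , eq , c) = true ∷ D , cong suc eq , c , n≢0⇒n>0 r≢0
  extend-right : HasComb right b r → HasComb right (suc b) (fork l r)
  extend-right (D , eq , c) = true ∷ D , cong suc eq , n≢0⇒n>0 l≢0 , c
  in-left : ∀ h → d ^ h < size l → ShapeOutcome a (suc b) h l
  in-left h = comb-or-shapes a (suc b) h l
  in-right : ∀ h → d ^ h < size r → ShapeOutcome (suc a) b h r
  in-right h lt = comb-or-shapes (suc a) b h r (subst (λ z → z ^ h < size r) (+-suc a b) lt)
  go : Split (size l) (size r) (d ^ suc h) (d ^ h) → ShapeOutcome (suc a) (suc b) (suc h) (fork l r)
  -- Only left combs of `l` gain this branching, so `a` alone is lowered there; in `r` it is `b`.
  -- Either way the base drops by one.
  go (firstLarge lt) =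
    Sum.map extend-left (Sum.map (has-comb-left right) has-shapes-left) (in-left (suc h) lt)
  go (secondLarge lt) =
    Sum.map (has-comb-right left) (Sum.map extend-right has-shapes-right) (in-right (suc h) lt)
  -- If neither side yields a comb, both have all shapes with `h` nodes, and the fork adds the root.
  go (bothMedium lt-l lt-r) with in-left h lt-l | in-right h lt-r
  ... | inj₁ c | _ = inj₁ (extend-left c)
  ... | inj₂ (inj₁ c) | _ = inj₂ (inj₁ (has-comb-left right c))
  ... | inj₂ (inj₂ _) | inj₁ c = inj₁ (has-comb-right left c)
  ... | inj₂ (inj₂ _) | inj₂ (inj₁ c) = inj₂ (inj₁ (extend-right c))
  ... | inj₂ (inj₂ hl) | inj₂ (inj₂ hr) = inj₂ (inj₂ (has-shapes-fork hl hr))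

-- Counting shapes

-- (k + 1) C(n, k+1) = (n - k) C(n, k), with k C(n, k) moved to the left so that no subtraction occurs.
absorption : ∀ n k → suc k * (n C suc k) + k * (n C k) ≡ n * (n C k)
absorption zero zero = refl
absorption zero (suc k) = cong₂ _+_ (*-zeroʳ (suc (suc k))) (*-zeroʳ (suc k))
absorption (suc n) zero = trans (cong (λ z → 1 * z + 0) (nC1≡n (suc n))) (ring n)
  where
  ring : ∀ n → 1 * suc n + 0 ≡ suc n * 1
  ring = solve-∀
absorption (suc n) (suc k)
  rewrite sym (nCk+nC[k+1]≡[n+1]C[k+1] n k) | sym (nCk+nC[k+1]≡[n+1]C[k+1] n (suc k)) =
  trans (regroup k (n C k) (n C suc k) (n C suc (suc k)))
    (trans (cong₂ (λ u v → u + v + (n C suc k + n C k)) (absorption n (suc k)) (absorption n k))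
      (collect n (n C k) (n C suc k)))
  where
  regroup : ∀ k a b c → suc (suc k) * (b + c) + suc k * (a + b) ≡
    (suc (suc k) * c + suc k * b) + (suc k * b + k * a) + (b + a)
  regroup = solve-∀
  collect : ∀ n a b → n * b + n * a + (b + a) ≡ suc n * (a + b)
  collect = solve-∀

graftFirst : ∀ {j} → Vec Shape (suc (suc j)) → Vec Shape (suc j)
graftFirst (σ ∷ τ ∷ v) = node σ τ ∷ v

-- Lists of j trees with m nodes in total.  Splitting the root of the first tree, or dropping
-- it if it is a leaf, gives the recursion of the ballot numbers.
forests : (m j : ℕ) → List (Vec Shape j)
forests zero zero = [] ∷ []
forests (suc m) zero = []
forests zero (suc j) = map (leaf ∷_) (forests zero j)
forests (suc m) (suc j) = map (leaf ∷_) (forests (suc m) j) ++ map graftFirst (forests m (suc (suc j)))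

total : ∀ {j} → Vec Shape j → ℕ
total [] = 0
total (σ ∷ v) = nodes σ + total v

total-graft : ∀ {j} (v : Vec Shape (suc (suc j))) → total (graftFirst v) ≡ suc (total v)
total-graft (σ ∷ τ ∷ v) = cong suc (+-assoc (nodes σ) (nodes τ) (total v))

forests-total : ∀ m j → All (λ v → total v ≡ m) (forests m j)
forests-total zero zero = refl ∷ []
forests-total (suc m) zero = []
forests-total zero (suc j) = All.map⁺ (forests-total zero j)
forests-total (suc m) (suc j) = All.++⁺ (All.map⁺ (forests-total (suc m) j))
  (All.map⁺ (All.map (λ {v} eq → trans (total-graft v) (cong suc eq)) (forests-total m (suc (suc j)))))

graftFirst-injective : ∀ {j} {v w : Vec Shape (suc (suc j))} → graftFirst v ≡ graftFirst w → v ≡ w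
graftFirst-injective {v = _ ∷ _ ∷ _} {_ ∷ _ ∷ _} refl = refl

-- The first tree tells the two kinds of lists apart: it is a leaf in one and a node in the other.
forests-unique : ∀ m j → Unique (forests m j)
forests-unique zero zero = [] ∷ []
forests-unique (suc m) zero = []
forests-unique zero (suc j) = Unique.map⁺ Vec.∷-injectiveʳ (forests-unique zero j)
forests-unique (suc m) (suc j) = Unique.++⁺
  (Unique.map⁺ Vec.∷-injectiveʳ (forests-unique (suc m) j))
  (Unique.map⁺ graftFirst-injective (forests-unique m (suc (suc j))))
  disjoint
  where
  disjoint : Disjoint (map (leaf ∷_) (forests (suc m) j)) (map graftFirst (forests m (suc (suc j))))
  disjoint (v∈ , v∈′) with ∈-map⁻ (leaf ∷_) v∈ | ∈-map⁻ graftFirst v∈′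
  ... | _ , _ , refl | (_ ∷ _ ∷ _) , _ , ()

-- The ballot numbers as a difference of binomials, with the subtracted term moved to the left. For
-- `j = 0` the two binomials agree by symmetry; the recursion on `j` is Pascal's rule.
forests-length : ∀ m j → length (forests (suc m) j) + ((m + suc m + j) C m) ≡ (m + suc m + j) C suc m
forests-length m zero = begin
  (m + suc m + 0) C m         ≡⟨ cong (_C m) (+-identityʳ _) ⟩
  (m + suc m) C m             ≡⟨ nCk≡nC[n∸k] (m≤m+n m (suc m)) ⟩
  (m + suc m) C (m + suc m ∸ m)  ≡⟨ cong₂ _C_ (sym (+-identityʳ _)) (m+n∸m≡n m (suc m)) ⟩
  (m + suc m + 0) C suc m     ∎
  where open ≡-Reasoning
forests-length m (suc j) = begin
  length (forests (suc m) (suc j)) + ((m + suc m + suc j) C m)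
    ≡⟨ cong (_+ ((m + suc m + suc j) C m)) (trans (length-++ (map (leaf ∷_) (forests (suc m) j)))
         (cong₂ _+_ (length-map _ (forests (suc m) j)) (length-map _ (forests m (suc (suc j)))))) ⟩
  length (forests (suc m) j) + length (forests m (suc (suc j))) + ((m + suc m + suc j) C m)
    ≡⟨ step m ⟩
  length (forests (suc m) j) + ((m + suc m + j) C m) + ((m + suc m + j) C m)
    ≡⟨ cong (_+ ((m + suc m + j) C m)) (forests-length m j) ⟩
  (m + suc m + j) C suc m + ((m + suc m + j) C m)
    ≡⟨ +-comm _ ((m + suc m + j) C m) ⟩
  (m + suc m + j) C m + ((m + suc m + j) C suc m)
    ≡⟨ nCk+nC[k+1]≡[n+1]C[k+1] (m + suc m + j) m ⟩
  suc (m + suc m + j) C suc m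
    ≡⟨ cong (_C suc m) (+-suc (m + suc m) j) ⟨
  (m + suc m + suc j) C suc m ∎
  where
  open ≡-Reasoning
  step : ∀ m → length (forests (suc m) j) + length (forests m (suc (suc j))) + ((m + suc m + suc j) C m) ≡
    length (forests (suc m) j) + ((m + suc m + j) C m) + ((m + suc m + j) C m)
  -- The formula covers only a positive number of nodes; with none there is exactly one list of each
  -- length.
  step zero = cong (λ z → length (forests 1 j) + z + 1) (zero-forest (suc (suc j)))
    where
    zero-forest : ∀ j → length (forests zero j) ≡ 1
    zero-forest zero = refl
    zero-forest (suc j) = trans (length-map _ (forests zero j)) (zero-forest j)
  step (suc m) = begin
    x + y + ((suc m + suc (suc m) + suc j) C suc m)
      ≡⟨ cong (λ z → x + y + (z C suc m)) (+-suc (suc m + suc (suc m)) j) ⟩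
    x + y + (suc N C suc m)
      ≡⟨ cong (x + y +_) (nCk+nC[k+1]≡[n+1]C[k+1] N m) ⟨
    x + y + (N C m + N C suc m)
      ≡⟨ regroup x y (N C m) (N C suc m) ⟩
    x + (y + N C m) + N C suc m
      ≡⟨ cong (λ z → x + z + N C suc m)
           (subst (λ M → y + M C m ≡ M C suc m) (N≡ m j) (forests-length m (suc (suc j)))) ⟩
    x + N C suc m + N C suc m ∎
    where
    N = suc m + suc (suc m) + j
    x = length (forests (suc (suc m)) j)
    y = length (forests (suc m) (suc (suc j)))
    N≡ : ∀ m j → m + suc m + suc (suc j) ≡ suc m + suc (suc m) + j
    N≡ = solve-∀
    regroup : ∀ x y u v → x + y + (u + v) ≡ x + (y + u) + v
    regroup = solve-∀

singleton : Vec Shape 1 → Shape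
singleton (σ ∷ []) = σ

shapes : ℕ → List Shape
shapes k = map singleton (forests k 1)

nodes-singleton : ∀ v → nodes (singleton v) ≡ total v
nodes-singleton (σ ∷ []) = sym (+-identityʳ (nodes σ))

singleton-injective : ∀ {v w} → singleton v ≡ singleton w → v ≡ w
singleton-injective {_ ∷ []} {_ ∷ []} refl = refl

shapes-nodes : ∀ k → All (λ σ → nodes σ ≡ k) (shapes k)
shapes-nodes k = All.map⁺ (All.map (λ {v} → trans (nodes-singleton v)) (forests-total k 1))

shapes-unique : ∀ k → Unique (shapes k)
shapes-unique k = Unique.map⁺ singleton-injective (forests-unique k 1)

-- With N = 2m + 2, the ballot formula gives F = C(N, m+1) - C(N, m), and `absorption` gives (m+2)
-- C(N, m) = (m+1) C(N, m+1). Hence (m+2) F = C(N, m+1).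
shapes-length : ∀ m → length (shapes (suc m)) ≡ catalan (suc m)
shapes-length m = begin
  length (shapes (suc m))                    ≡⟨ length-map singleton (forests (suc m) 1) ⟩
  F                                          ≡⟨ m*n/n≡m F (suc (suc m)) ⟨
  F * suc (suc m) / suc (suc m)              ≡⟨ cong (_/ suc (suc m)) (trans times (cong (_C suc m) N≡)) ⟩
  catalan (suc m)                            ∎
  where
  open ≡-Reasoning
  F = length (forests (suc m) 1)
  N = m + suc m + 1
  N≡ : N ≡ 2 * suc m
  N≡ = ring m
    where
    ring : ∀ m → m + suc m + 1 ≡ 2 * suc m
    ring = solve-∀
  ratio : suc (suc m) * (N C m) ≡ suc m * (N C suc m)
  ratio = +-cancelʳ-≡ (m * (N C m)) _ _ (begin
    suc (suc m) * (N C m) + m * (N C m)      ≡⟨ ring m (N C m) ⟩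
    N * (N C m)                              ≡⟨ absorption N m ⟨
    suc m * (N C suc m) + m * (N C m)        ∎)
    where
    ring : ∀ m c → suc (suc m) * c + m * c ≡ (m + suc m + 1) * c
    ring = solve-∀
  times : F * suc (suc m) ≡ N C suc m
  times = +-cancelʳ-≡ (suc m * (N C suc m)) _ _ (begin
    F * suc (suc m) + suc m * (N C suc m)    ≡⟨ cong (F * suc (suc m) +_) ratio ⟨
    F * suc (suc m) + suc (suc m) * (N C m)  ≡⟨ factor m F (N C m) ⟩
    suc (suc m) * (F + N C m)                ≡⟨ cong (suc (suc m) *_) (forests-length m 1) ⟩
    suc (suc m) * (N C suc m)                ∎)
    where
    factor : ∀ m f c → f * suc (suc m) + suc (suc m) * c ≡ suc (suc m) * (f + c)
    factor = solve-∀

-- The colourings for (a) and (b)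

-- The minimum of `i` and `p`: surplus indices share the last colour.
truncate : ∀ {p} → ℕ → Fin (suc p)
truncate zero = zero
truncate {zero} (suc i) = zero
truncate {suc p} (suc i) = suc (truncate i)

toℕ-truncate : ∀ {p i} → i ≤ p → toℕ (truncate {p} i) ≡ i
toℕ-truncate z≤n = refl
toℕ-truncate (s≤s i≤p) = cong suc (toℕ-truncate i≤p)

truncate-toℕ : ∀ {p} (i : Fin (suc p)) → truncate (toℕ i) ≡ i
truncate-toℕ zero = refl
truncate-toℕ {suc p} (suc i) = cong suc (truncate-toℕ i)

module _ {A : Set} (_≟_ : DecidableEquality A) where

  indexOf : List A → A → ℕ
  indexOf [] y = 0
  indexOf (x ∷ xs) y with x ≟ y
  ... | yes _ = 0
  ... | no _ = suc (indexOf xs y)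

  indexOf-lookup : ∀ {xs} → Unique xs → ∀ i → indexOf xs (lookup xs i) ≡ toℕ i
  indexOf-lookup {x ∷ xs} _ zero with x ≟ x
  ... | yes _ = refl
  ... | no x≢x = ⊥-elim (x≢x refl)
  indexOf-lookup {x ∷ xs} (x∉ ∷ uniq) (suc i) with x ≟ lookup xs i
  ... | yes eq = ⊥-elim (All.lookup x∉ (∈-lookup i) eq)
  ... | no _ = cong suc (indexOf-lookup uniq i)

  remove : A → List A → List A
  remove y = filter (λ x → ¬? (x ≟ y))

  -- Without repetitions, `y` is found at most once.
  length-remove : ∀ y {xs} → Unique xs → length xs ≤ suc (length (remove y xs))
  length-remove y {[]} _ = z≤n
  length-remove y {x ∷ xs} (x∉ ∷ uniq) with x ≟ y
  ... | no _ = s≤s (length-remove y uniq)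
  ... | yes refl = s≤s (≤-reflexive (sym (cong length
    (filter-all (λ z → ¬? (z ≟ y)) (All.map (λ y≢z z≡y → y≢z (sym z≡y)) x∉)))))

node-injective : ∀ {σ τ σ′ τ′} → node σ τ ≡ node σ′ τ′ → σ ≡ σ′ × τ ≡ τ′
node-injective refl = refl , refl

_≟ˢ_ : DecidableEquality Shape
leaf ≟ˢ leaf = yes refl
leaf ≟ˢ node _ _ = no λ ()
node _ _ ≟ˢ leaf = no λ ()
node σ τ ≟ˢ node σ′ τ′ = map′ (λ (p , q) → cong₂ node p q) node-injective (σ ≟ˢ σ′ ×-dec τ ≟ˢ τ′)

-- For `k = 1` both combs are `node leaf leaf`.
combs-distinct : ∀ {k} → 2 ≤ k → combShape right k ≢ combShape left k
combs-distinct (s≤s (s≤s _)) ()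

others : ℕ → List Shape
others k = remove _≟ˢ_ (combShape left k) (remove _≟ˢ_ (combShape right k) (shapes k))

others-unique : ∀ k → Unique (others k)
others-unique k = Unique.filter⁺ _ (Unique.filter⁺ _ (shapes-unique k))

others-length : ∀ {k} → 1 ≤ k → catalan k ∸ 2 ≤ length (others k)
others-length {suc k} _ = m≤n+o⇒m∸n≤o _ 2 (begin
  catalan (suc k)           ≡⟨ shapes-length k ⟨
  length (shapes (suc k))   ≤⟨ length-remove _≟ˢ_ (combShape right (suc k)) (shapes-unique (suc k)) ⟩
  suc (length (remove _≟ˢ_ (combShape right (suc k)) (shapes (suc k))))
    ≤⟨ s≤s (length-remove _≟ˢ_ (combShape left (suc k)) (Unique.filter⁺ _ (shapes-unique (suc k)))) ⟩
  2 + length (others (suc k)) ∎)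
  where open ≤-Reasoning

record Other (k : ℕ) (σ : Shape) : Set where
  field
    nodes≡k  : nodes σ ≡ k
    ≢comb    : ∀ s → σ ≢ combShape s k

others-other : ∀ k i → Other k (lookup (others k) i)
others-other k i = record
  { nodes≡k = All.lookup (All.filter⁺ _ (All.filter⁺ _ (shapes-nodes k))) (∈-lookup i)
  ; ≢comb = λ where
      left → All.lookup (All.all-filter _ (remove _≟ˢ_ (combShape right k) (shapes k))) (∈-lookup i)
      right → All.lookup (All.filter⁺ _ (All.all-filter _ (shapes k))) (∈-lookup i)
  }

-- Total on subsets, so that trees can be coloured without a proof of size; outside the edges the
-- value is arbitrary.
extend : ∀ {k n q} → Colouring k n (suc q) → Subset n → Fin (suc q)
extend {k} χ D with ∣ D ∣ ≟ k
... | yes size = χ (D , size)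
... | no _ = zero

extend-edge : ∀ {k n q} (χ : Colouring k n (suc q)) e → extend χ (proj₁ e) ≡ χ e
extend-edge {k} χ (D , size) with ∣ D ∣ ≟ k
... | yes size′ = cong (λ z → χ (D , z)) (≡-irrelevant size′ size)
... | no size≢ = ⊥-elim (size≢ size)

-- Common to (a) and (b): `embed` chooses the palette of each kind of comb, and `project` recovers
-- the colour of `χ` from either palette.
module ShapeColouring {k n q Q : ℕ} (2≤k : 2 ≤ k) (χ : Colouring k n (suc q))
  (embed : Side → Fin (suc q) → Fin Q) (project : Fin Q → Fin (suc q))
  (project-embed : ∀ s i → project (embed s i) ≡ i)
  (default : Fin Q) (classify : Shape → Fin Q) where

  shapeColour : Shape → Subset n → Fin Q
  shapeColour σ D with σ ≟ˢ combShape left k | σ ≟ˢ combShape right k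
  ... | yes _ | _ = embed left (extend χ D)
  ... | no _ | yes _ = embed right (extend χ D)
  ... | no _ | no _ = classify σ

  shapeColour-comb : ∀ s D → shapeColour (combShape s k) D ≡ embed s (extend χ D)
  shapeColour-comb left D with combShape left k ≟ˢ combShape left k
  ... | yes _ = refl
  ... | no ≢ = ⊥-elim (≢ refl)
  shapeColour-comb right D
    with combShape right k ≟ˢ combShape left k | combShape right k ≟ˢ combShape right k
  ... | yes eq | _ = ⊥-elim (combs-distinct 2≤k eq)
  ... | no _ | yes _ = refl
  ... | no _ | no ≢ = ⊥-elim (≢ refl)

  shapeColour-other : ∀ {σ} → Other k σ → ∀ D → shapeColour σ D ≡ classify σ
  shapeColour-other {σ} other D with σ ≟ˢ combShape left k | σ ≟ˢ combShape right k
  ... | yes eq | _ = ⊥-elim (Other.≢comb other left eq)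
  ... | no _ | yes eq = ⊥-elim (Other.≢comb other right eq)
  ... | no _ | no _ = refl

  treeColour : Tree n → Fin Q
  treeColour T = maybe′ (λ σ → shapeColour σ (levels T)) default (shape T)

  AllShapesIn : Subset Q → Set
  AllShapesIn D = ∀ σ → nodes σ ≡ k → ∃[ E ] shapeColour σ E ∈ D

  -- On a long comb, each edge of `χ` is the set of branching depths of a smaller comb with `k + 1`
  -- leaves, whose colour lies in `D` and projects to that of `χ`. Otherwise all shapes with `k`
  -- nodes occur.
  dichotomy : ∀ {t h s p} → k ≤ h → (t + t) ^ h < s → TreeUnavoidable (k + 1) s p treeColour →
    (∃[ S ] ∣ S ∣ ≡ t × FewColours p χ S) ⊎ (∃[ D ] ∣ D ∣ < p × AllShapesIn D)
  dichotomy {t} {h} {p = p} k≤h big (T , refl , D , D<p , colours) = go (comb-or-shapes t t h T big)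
    where
    realised : ∀ {σ E} → nodes σ ≡ k → Realises T σ E → shapeColour σ E ∈ D
    realised {σ} eq (T′ , T′⊑ , shape-eq , refl) =
      subst (_∈ D) (cong (maybe′ (λ τ → shapeColour τ (levels T′)) default) shape-eq)
        (colours T′⊑ (trans (size-of-shape T′ shape-eq) (trans (cong suc eq) (+-comm 1 k))))
    from-comb : ∀ s → HasComb s t T → ∃[ S ] ∣ S ∣ ≡ t × FewColours p χ S
    from-comb s (S , ∣S∣≡t , comb) = S , ∣S∣≡t , few-colours χ S D project D<p covers
      where
      covers : ∀ e → proj₁ e ⊆ S → ∃[ j ] j ∈ D × project j ≡ χ e
      covers e@(E , refl) E⊆S =
        _ , realised (nodes-comb s k) (realises-comb s E T (comb-⊆ s E⊆S comb)) ,
        trans (cong project (shapeColour-comb s E)) (trans (project-embed s _) (extend-edge χ e))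
    go : ShapeOutcome t t h T → _
    go (inj₁ c) = inj₁ (from-comb left c)
    go (inj₂ (inj₁ c)) = inj₁ (from-comb right c)
    go (inj₂ (inj₂ has)) = inj₂ (D , D<p , λ σ eq →
      let E , real = has σ (≤-trans (≤-reflexive eq) k≤h) in E , realised eq real)

module _ {k n q t h s : ℕ} (2≤k : 2 ≤ k) (k≤h : k ≤ h) (big : (t + t) ^ h < s)
  (χ : Colouring k n (suc q)) where

  -- Shapes may reuse colours of `χ`: on a long comb only combs are looked at, and otherwise the
  -- first `suc p` other shapes alone receive `suc p` colours.
  step-up-same : ∀ {p} → suc p ≤ catalan k ∸ 2 → p ≤ q →
    (∀ (colour : Tree n → Fin (suc q)) → TreeUnavoidable (k + 1) s (suc p) colour) →
    ∃[ S ] ∣ S ∣ ≡ t × FewColours (suc p) χ S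
  step-up-same {p} p≤catalan p≤q unavoidable = [ id , absurd ]′ (dichotomy k≤h big (unavoidable treeColour))
    where
    p≤others : suc p ≤ length (others k)
    p≤others = ≤-trans p≤catalan (others-length (≤-trans (s≤s z≤n) 2≤k))
    classify : Shape → Fin (suc q)
    classify σ = truncate (indexOf _≟ˢ_ (others k) σ)
    open ShapeColouring 2≤k χ (λ _ → id) id (λ _ _ → refl) zero classify
    class : Fin (suc q) → Fin (suc p)
    class j = truncate (toℕ j)
    class-other : ∀ i E → class (shapeColour (lookup (others k) (inject≤ i p≤others)) E) ≡ i
    class-other i E = begin
      class (shapeColour (lookup (others k) (inject≤ i p≤others)) E)
        ≡⟨ cong class (shapeColour-other (others-other k (inject≤ i p≤others)) E) ⟩
      class (classify (lookup (others k) (inject≤ i p≤others)))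
        ≡⟨ cong (class ∘ truncate) (trans (indexOf-lookup _≟ˢ_ (others-unique k) _) (Fin.toℕ-inject≤ i p≤others)) ⟩
      class (truncate (toℕ i))
        -- `classify` cuts at `q` and `class` at `p`; an index `i ≤ p ≤ q` survives both.
        ≡⟨ cong truncate (toℕ-truncate (≤-trans (s≤s⁻¹ (Fin.toℕ<n i)) p≤q)) ⟩
      truncate (toℕ i)
        ≡⟨ truncate-toℕ i ⟩
      i ∎
      where open ≡-Reasoning
    absurd : ∃[ D ] ∣ D ∣ < suc p × AllShapesIn D → _
    absurd (D , D<p , all) = ⊥-elim (<⇒≱ D<p (surjective-≤ D class onto))
      where
      onto : ∀ i → ∃[ j ] j ∈ D × class j ≡ i
      onto i with all _ (Other.nodes≡k (others-other k (inject≤ i p≤others)))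
      ... | E , j∈D = _ , j∈D , class-other i E

  -- With separate palettes each comb contributes a class of its own, so only `suc p` of the `3 + p`
  -- classes have to come from other shapes.
  step-up-fresh : ∀ {p} → 3 + p ≤ catalan k →
    (∀ (colour : Tree n → Fin (2 * suc q + (3 + p))) → TreeUnavoidable (k + 1) s (3 + p) colour) →
    ∃[ S ] ∣ S ∣ ≡ t × FewColours (3 + p) χ S
  step-up-fresh {p} p≤catalan unavoidable = [ id , absurd ]′ (dichotomy k≤h big (unavoidable treeColour))
    where
    p≤others : suc p ≤ length (others k)
    p≤others = ≤-trans (∸-monoˡ-≤ 2 p≤catalan) (others-length (≤-trans (s≤s z≤n) 2≤k))
    side : Side → Fin 2
    side left = zero
    side right = suc zero
    embed : Side → Fin (suc q) → Fin (2 * suc q + (3 + p))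
    embed s i = combine (side s) i ↑ˡ (3 + p)
    project : Fin (2 * suc q + (3 + p)) → Fin (suc q)
    project j = [ (λ x → proj₂ (remQuot {2} (suc q) x)) , (λ _ → zero) ]′ (splitAt (2 * suc q) j)
    project-embed : ∀ s i → project (embed s i) ≡ i
    project-embed s i rewrite Fin.splitAt-↑ˡ (2 * suc q) (combine (side s) i) (3 + p) =
      cong proj₂ (Fin.remQuot-combine (side s) i)
    classify : Shape → Fin (2 * suc q + (3 + p))
    -- Two fresh colours are skipped: `class` keeps 0 and 1 for the palettes of the left and right
    -- combs.
    classify σ = (2 * suc q) ↑ʳ suc (suc (truncate (indexOf _≟ˢ_ (others k) σ)))
    open ShapeColouring 2≤k χ embed project project-embed zero classify
    class : Fin (2 * suc q + (3 + p)) → Fin (3 + p)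
    class j = [ (λ x → proj₁ (remQuot {2} (suc q) x) ↑ˡ suc p) , id ]′ (splitAt (2 * suc q) j)
    class-embed : ∀ s i → class (embed s i) ≡ side s ↑ˡ suc p
    class-embed s i rewrite Fin.splitAt-↑ˡ (2 * suc q) (combine (side s) i) (3 + p) =
      cong (λ z → proj₁ z ↑ˡ suc p) (Fin.remQuot-combine (side s) i)
    class-other : ∀ i E → class (shapeColour (lookup (others k) (inject≤ i p≤others)) E) ≡ suc (suc i)
    class-other i E = begin
      class (shapeColour (lookup (others k) (inject≤ i p≤others)) E)
        ≡⟨ cong class (shapeColour-other (others-other k (inject≤ i p≤others)) E) ⟩
      class (classify (lookup (others k) (inject≤ i p≤others)))
        ≡⟨ cong [ _ , id ]′ (Fin.splitAt-↑ʳ (2 * suc q) (3 + p) _) ⟩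
      suc (suc (truncate (indexOf _≟ˢ_ (others k) (lookup (others k) (inject≤ i p≤others)))))
        ≡⟨ cong (λ z → suc (suc (truncate z)))
             (trans (indexOf-lookup _≟ˢ_ (others-unique k) _) (Fin.toℕ-inject≤ i p≤others)) ⟩
      suc (suc (truncate (toℕ i)))
        ≡⟨ cong (λ z → suc (suc z)) (truncate-toℕ i) ⟩
      suc (suc i) ∎
      where open ≡-Reasoning
    absurd : ∃[ D ] ∣ D ∣ < 3 + p × AllShapesIn D → _
    absurd (D , D<p , all) = ⊥-elim (<⇒≱ D<p (surjective-≤ D class onto))
      where
      onto-side : ∀ s → ∃[ j ] j ∈ D × class j ≡ side s ↑ˡ suc p
      onto-side s with all (combShape s k) (nodes-comb s k)
      ... | E , j∈D = _ , j∈D , trans (cong class (shapeColour-comb s E)) (class-embed s (extend χ E))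
      onto : ∀ i → ∃[ j ] j ∈ D × class j ≡ i
      onto zero = onto-side left
      onto (suc zero) = onto-side right
      onto (suc (suc i)) with all _ (Other.nodes≡k (others-other k (inject≤ i p≤others)))
      ... | E , j∈D = _ , j∈D , class-other i E

-- The colouring for (c)

before : ℕ → ℕ → ℕ
before y zero = 0
before zero (suc x) = 1
before (suc y) (suc x) = before y x

before-< : ∀ {y x} → y < x → before y x ≡ 1
before-< {zero} (s≤s _) = refl
before-< {suc y} (s≤s lt) = before-< lt

before-≥ : ∀ {y x} → x ≤ y → before y x ≡ 0
before-≥ z≤n = refl
before-≥ (s≤s le) = before-≥ le

StrictlyMonotone : (ℕ → ℕ) → Set
StrictlyMonotone f = ∀ {x y} → x < y → f x < f y

before-map : ∀ {f} → StrictlyMonotone f → ∀ y x → before (f y) (f x) ≡ before y x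
before-map {f} mono y x with y <? x
... | yes y<x = trans (before-< (mono y<x)) (sym (before-< y<x))
... | no y≮x = trans (before-≥ (weaken (≮⇒≥ y≮x))) (sym (before-≥ (≮⇒≥ y≮x)))
  where
  weaken : ∀ {x y} → x ≤ y → f x ≤ f y
  weaken {x} {y} x≤y with m≤n⇒m<n∨m≡n x≤y
  ... | inj₁ x<y = <⇒≤ (mono x<y)
  ... | inj₂ refl = ≤-refl

rank : ℕ → List ℕ → ℕ
rank x [] = 0
rank x (y ∷ ys) = before y x + rank x ys

rank-map : ∀ {x x′} (f : ℕ → ℕ) → (∀ y → before (f y) x′ ≡ before y x) →
  ∀ ys → rank x′ (map f ys) ≡ rank x ys
rank-map f eq [] = refl
rank-map f eq (y ∷ ys) = cong₂ _+_ (eq y) (rank-map f eq ys)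

-- The Lehmer code, read in the factorial number system.
code : List ℕ → ℕ
code [] = 0
code (x ∷ xs) = rank x xs + code xs * suc (length xs)

-- The code sees only the relative order of the entries, so depths may be renumbered.
code-map : ∀ {f} → StrictlyMonotone f → ∀ xs → code (map f xs) ≡ code xs
code-map mono [] = refl
code-map {f} mono (x ∷ xs) = cong₂ _+_ (rank-map f (λ y → before-map mono y x) xs)
  (cong₂ (λ c n → c * suc n) (code-map mono xs) (length-map f xs))

-- The increasing enumeration of the numbers other than `r`.
punch : ℕ → ℕ → ℕ
punch zero y = suc y
punch (suc r) zero = zero
punch (suc r) (suc y) = suc (punch r y)

punch-monotone : ∀ r → StrictlyMonotone (punch r)
punch-monotone zero lt = s≤s lt
punch-monotone (suc r) {zero} (s≤s _) = s≤s z≤n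
punch-monotone (suc r) {suc x} (s≤s lt) = s≤s (punch-monotone r lt)

punch-≤ : ∀ r y → punch r y ≤ suc y
punch-≤ zero y = ≤-refl
punch-≤ (suc r) zero = z≤n
punch-≤ (suc r) (suc y) = s≤s (punch-≤ r y)

before-punch-≤ : ∀ {r j} → j ≤ r → ∀ y → before (punch r y) j ≡ before y j
before-punch-≤ z≤n y = refl
before-punch-≤ (s≤s j≤r) zero = refl
before-punch-≤ (s≤s j≤r) (suc y) = before-punch-≤ j≤r y

before-punch-> : ∀ {r j} → r ≤ j → ∀ y → before (punch r y) (suc j) ≡ before y j
before-punch-> z≤n y = refl
before-punch-> (s≤s r≤j) zero = refl
before-punch-> (s≤s r≤j) (suc y) = before-punch-> r≤j y

rank-punch-≤ : ∀ {r j} → j ≤ r → ∀ ys → rank j (map (punch r) ys) ≡ rank j ys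
rank-punch-≤ {r} {j} j≤r = rank-map {j} {j} (punch r) (before-punch-≤ j≤r)

rank-punch-> : ∀ {r j} → r ≤ j → ∀ ys → rank (suc j) (map (punch r) ys) ≡ rank j ys
rank-punch-> {r} {j} r≤j = rank-map {j} {suc j} (punch r) (before-punch-> r≤j)

-- The inverse of `code`: the last digit of `m` is the first entry, and the other values are
-- arranged according to the remaining digits.
permutation : ℕ → ℕ → List ℕ
permutation zero m = []
permutation (suc k) m = m % suc k ∷ map (punch (m % suc k)) (permutation k (m / suc k))

permutation-length : ∀ k m → length (permutation k m) ≡ k
permutation-length zero m = refl
permutation-length (suc k) m = cong suc
  (trans (length-map _ (permutation k (m / suc k))) (permutation-length k (m / suc k)))

permutation-< : ∀ k m → All (_< k) (permutation k m)
permutation-< zero m = []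
permutation-< (suc k) m = m%n<n m (suc k) ∷
  All.map⁺ (All.map (λ {y} y<k → ≤-<-trans (punch-≤ _ y) (s≤s y<k)) (permutation-< k (m / suc k)))

-- The entries are 0 to k - 1 in some order, so exactly `j` of them lie below `j`. Inductively, the
-- first entry is counted when `j` exceeds it, and `punch` preserves the other comparisons.
permutation-rank : ∀ k m {j} → j ≤ k → rank j (permutation k m) ≡ j
permutation-rank zero m z≤n = refl
permutation-rank (suc k) m {j} j≤k with j ≤? m % suc k
... | yes j≤r = cong₂ _+_ (before-≥ j≤r)
  (trans (rank-punch-≤ j≤r (permutation k (m / suc k)))
    (permutation-rank k (m / suc k) (≤-trans j≤r (s≤s⁻¹ (m%n<n m (suc k))))))
permutation-rank (suc k) m {zero} j≤k | no j≰r = ⊥-elim (j≰r z≤n)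
permutation-rank (suc k) m {suc j} (s≤s j≤k) | no j≰r = cong₂ _+_ (before-< (≰⇒> j≰r))
  (trans (rank-punch-> (s≤s⁻¹ (≰⇒> j≰r)) (permutation k (m / suc k)))
    (permutation-rank k (m / suc k) j≤k))

code-permutation : ∀ k {m} → m < k ! → code (permutation k m) ≡ m
code-permutation zero {zero} _ = refl
code-permutation zero {suc m} (s≤s ())
code-permutation (suc k) {m} m<k! = begin
  rank r (map (punch r) π) + code (map (punch r) π) * suc (length (map (punch r) π))
    ≡⟨ cong₂ _+_
         (trans (rank-punch-≤ {r} ≤-refl π) (permutation-rank k (m / suc k) (s≤s⁻¹ (m%n<n m (suc k)))))
         (cong₂ (λ c n → c * suc n)
           (trans (code-map (punch-monotone r) π)
             (code-permutation k (m<n*o⇒m/o<n (subst (m <_) (*-comm (suc k) (k !)) m<k!))))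
           (trans (length-map _ π) (permutation-length k _))) ⟩
  r + (m / suc k) * suc k
    ≡⟨ m≡m%n+[m/n]*n m (suc k) ⟨
  m ∎
  where
  open ≡-Reasoning
  r = m % suc k
  π = permutation k (m / suc k)

-- Lists of leaves and separation depths

-- In lexicographic order, so edges v_1 < ... < v_2k are sublists.
leaves : ∀ {n} → Tree n → List (Vec Bool n)
leaves (tip true) = [] ∷ []
leaves (tip false) = []
leaves (fork l r) = map (false ∷_) (leaves l) ++ map (true ∷_) (leaves r)

length-leaves : ∀ {n} (T : Tree n) → length (leaves T) ≡ size T
length-leaves (tip true) = refl
length-leaves (tip false) = refl
length-leaves (fork l r) = trans (length-++ (map (false ∷_) (leaves l)))
  (cong₂ _+_ (trans (length-map _ (leaves l)) (length-leaves l)) (trans (length-map _ (leaves r)) (length-leaves r)))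

module _ {A : Set} where

  sublist-++ : ∀ (xs : List A) {ys zs} → zs ⊆ˡ xs ++ ys →
    ∃[ us ] ∃[ vs ] us ⊆ˡ xs × vs ⊆ˡ ys × zs ≡ us ++ vs
  sublist-++ [] sub = [] , _ , [] , sub , refl
  sublist-++ (x ∷ xs) (.x ∷ʳ sub) with sublist-++ xs sub
  ... | us , vs , us⊆ , vs⊆ , eq = us , vs , x ∷ʳ us⊆ , vs⊆ , eq
  sublist-++ (x ∷ xs) (refl ∷ sub) with sublist-++ xs sub
  ... | us , vs , us⊆ , vs⊆ , eq = x ∷ us , vs , refl ∷ us⊆ , vs⊆ , cong (x ∷_) eq

  sublist-map : ∀ {B : Set} (f : A → B) xs {zs} → zs ⊆ˡ map f xs → ∃[ us ] us ⊆ˡ xs × zs ≡ map f us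
  sublist-map f [] [] = [] , [] , refl
  sublist-map f (x ∷ xs) (_ ∷ʳ sub) with sublist-map f xs sub
  ... | us , us⊆ , eq = us , x ∷ʳ us⊆ , eq
  sublist-map f (x ∷ xs) (refl ∷ sub) with sublist-map f xs sub
  ... | us , us⊆ , eq = x ∷ us , refl ∷ us⊆ , cong (f x ∷_) eq

subtree : ∀ {n} (T : Tree n) {L} → L ⊆ˡ leaves T → ∃[ T′ ] T′ ⊑ T × leaves T′ ≡ L
subtree (tip false) [] = ∅ , ∅⊑ , refl
subtree (tip true) (_ ∷ʳ []) = ∅ , ∅⊑ , refl
subtree (tip true) (refl ∷ []) = tip true , tip bool≤refl , refl
subtree (fork l r) sub with sublist-++ (map (false ∷_) (leaves l)) sub
... | _ , _ , sub-l , sub-r , refl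
  with sublist-map _ (leaves l) sub-l | sublist-map _ (leaves r) sub-r
... | _ , sub-l′ , refl | _ , sub-r′ , refl with subtree l sub-l′ | subtree r sub-r′
... | T , T⊑ , refl | U , U⊑ , refl = fork T U , fork T⊑ U⊑ , refl

-- The depth at which two strings separate; n if they are equal.
δ : ∀ {n} → Vec Bool n → Vec Bool n → ℕ
δ [] [] = 0
δ (false ∷ u) (false ∷ v) = suc (δ u v)
δ (true ∷ u) (true ∷ v) = suc (δ u v)
δ (false ∷ u) (true ∷ v) = 0
δ (true ∷ u) (false ∷ v) = 0

δ-∷ : ∀ {n} b (u v : Vec Bool n) → δ (b ∷ u) (b ∷ v) ≡ suc (δ u v)
δ-∷ false u v = refl
δ-∷ true u v = refl

-- Separations of the first and second string, the third and fourth, and so on; `steps` takes all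
-- consecutive pairs.
gaps : ∀ {n} → List (Vec Bool n) → List ℕ
gaps (u ∷ v ∷ L) = δ u v ∷ gaps L
gaps _ = []

gaps-map : ∀ {n} b (L : List (Vec Bool n)) → gaps (map (b ∷_) L) ≡ map suc (gaps L)
gaps-map b [] = refl
gaps-map b (u ∷ []) = refl
gaps-map b (u ∷ v ∷ L) = cong₂ _∷_ (δ-∷ b u v) (gaps-map b L)

steps : ∀ {n} → List (Vec Bool n) → List ℕ
steps (u ∷ v ∷ L) = δ u v ∷ steps (v ∷ L)
steps _ = []

steps-map : ∀ {n} b (L : List (Vec Bool n)) → steps (map (b ∷_) L) ≡ map suc (steps L)
steps-map b [] = refl
steps-map b (u ∷ []) = refl
steps-map b (u ∷ v ∷ L) = cong₂ _∷_ (δ-∷ b u v) (steps-map b (v ∷ L))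

steps-++ˡ : ∀ {n x} (L M : List (Vec Bool n)) → x ∈ˡ steps L → x ∈ˡ steps (L ++ M)
steps-++ˡ (u ∷ v ∷ L) M (here eq) = here eq
steps-++ˡ (u ∷ v ∷ L) M (there x∈) = there (steps-++ˡ (v ∷ L) M x∈)

steps-∷ : ∀ {n x} u (L : List (Vec Bool n)) → x ∈ˡ steps L → x ∈ˡ steps (u ∷ L)
steps-∷ u (v ∷ L) x∈ = there x∈

steps-++ʳ : ∀ {n x} (L M : List (Vec Bool n)) → x ∈ˡ steps M → x ∈ˡ steps (L ++ M)
steps-++ʳ [] M x∈ = x∈
steps-++ʳ (u ∷ L) M x∈ = steps-∷ u (L ++ M) (steps-++ʳ L M x∈)

steps-junction : ∀ {n} (L M : List (Vec Bool n)) → 0 < length L → 0 < length M →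
  0 ∈ˡ steps (map (false ∷_) L ++ map (true ∷_) M)
steps-junction (u ∷ []) (v ∷ M) _ _ = here refl
steps-junction (u ∷ u′ ∷ L) M _ M>0 = there (steps-junction (u′ ∷ L) M (s≤s z≤n) M>0)

-- A consecutive pair starts at an odd or an even position, and dropping the first string exchanges
-- the parities.
steps⇒gaps : ∀ {n x} (L : List (Vec Bool n)) → x ∈ˡ steps L → x ∈ˡ gaps L ⊎ x ∈ˡ gaps (drop 1 L)
steps⇒gaps (u ∷ v ∷ L) (here eq) = inj₁ (here eq)
steps⇒gaps (u ∷ v ∷ L) (there x∈) = [ inj₂ , inj₁ ∘ there ]′ (steps⇒gaps (v ∷ L) x∈)

nonempty⇒leaves : ∀ {n} (T : Tree n) → nonempty T ≡ true → 0 < length (leaves T)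
nonempty⇒leaves T eq rewrite length-leaves T | size-shape T with shape T
nonempty⇒leaves T refl | just _ = s≤s z≤n

size⇒nonempty : ∀ {n} (T : Tree n) → 0 < size T → nonempty T ≡ true
size⇒nonempty T lt rewrite size-shape T with shape T
... | just _ = refl

∧-true : ∀ a b → a ∧ b ≡ true → a ≡ true × b ≡ true
∧-true true true _ = refl , refl

-- A branching separates the last leaf on its left from the first leaf on its right, and these are
-- consecutive.
levels⇒steps : ∀ {n i} (T : Tree n) → i ∈ levels T → toℕ i ∈ˡ steps (leaves T)
levels⇒steps {i = zero} (fork l r) i∈ with nonempty l ∧ nonempty r in eq
levels⇒steps {i = zero} (fork l r) here | true with ∧-true _ _ eq
... | l≢∅ , r≢∅ = steps-junction (leaves l) (leaves r) (nonempty⇒leaves l l≢∅) (nonempty⇒leaves r r≢∅)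
levels⇒steps {i = suc i} (fork l r) (there i∈) with x∈p∪q⁻ (levels l) (levels r) i∈
... | inj₁ i∈l = steps-++ˡ (map (false ∷_) (leaves l)) _
  (subst (suc (toℕ i) ∈ˡ_) (sym (steps-map false (leaves l))) (∈-map⁺ suc (levels⇒steps l i∈l)))
... | inj₂ i∈r = steps-++ʳ (map (false ∷_) (leaves l)) _
  (subst (suc (toℕ i) ∈ˡ_) (sym (steps-map true (leaves r))) (∈-map⁺ suc (levels⇒steps r i∈r)))

fromList : ∀ {n} → List ℕ → Subset n
fromList xs = comprehension (λ i → ∈ˡ? _≟_ (toℕ i) xs)

∈-fromList⁺ : ∀ {n} {i : Fin n} xs → toℕ i ∈ˡ xs → i ∈ fromList xs
∈-fromList⁺ xs = ∈-comprehension⁺ (λ i → ∈ˡ? _≟_ (toℕ i) xs)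

∈-fromList⁻ : ∀ {n} {i : Fin n} xs → i ∈ fromList xs → toℕ i ∈ˡ xs
∈-fromList⁻ xs = ∈-comprehension⁻ (λ i → ∈ˡ? _≟_ (toℕ i) xs)

levels⊆gaps : ∀ {n} (T : Tree n) →
  levels T ⊆ fromList (gaps (leaves T)) ∪ fromList (gaps (drop 1 (leaves T)))
levels⊆gaps T i∈ = x∈p∪q⁺ ([ inj₁ ∘ ∈-fromList⁺ _ , inj₂ ∘ ∈-fromList⁺ _ ]′
  (steps⇒gaps (leaves T) (levels⇒steps T i∈)))

∣p∣≡suc∣p-x∣ : ∀ {n} {p : Subset n} {x} → x ∈ p → ∣ p ∣ ≡ suc ∣ p - x ∣
∣p∣≡suc∣p-x∣ {p = _ ∷ p} here = cong (suc ∘ ∣_∣) (sym (p─⊥≡p p))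
∣p∣≡suc∣p-x∣ {p = true ∷ p} (there x∈p) = cong suc (∣p∣≡suc∣p-x∣ x∈p)
∣p∣≡suc∣p-x∣ {p = false ∷ p} (there x∈p) = ∣p∣≡suc∣p-x∣ x∈p

x∉p-x : ∀ {n} (p : Subset n) x → ¬ (x ∈ p - x)
x∉p-x (_ ∷ p) (suc x) (there x∈) = x∉p-x p x x∈
x∉p-x (_ ∷ p) zero ()

select-none : ∀ {n m} (L : List (Vec Bool n)) (D : Subset m) → (∀ {i} → ¬ (i ∈ D)) →
  ∃[ M ] M ⊆ˡ L × length M ≡ 2 * ∣ D ∣ × fromList (gaps M) ≡ D
select-none {m = m} L D ∉D with Empty-unique (λ (i , i∈D) → ∉D i∈D)
... | refl = [] , minimum L , cong (2 *_) (sym (∣⊥∣≡0 m)) ,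
  ⊆-antisym (λ i∈ → ⊥-elim (¬Any[] (∈-fromList⁻ [] i∈))) (λ i∈⊥ → ⊥-elim (∉D i∈⊥))

-- A pair is kept when its depth is still wanted, and the depth is then struck from `D`, so a
-- repeated depth contributes once. Discarding whole pairs preserves the pairing of the others.
select-gaps : ∀ {n m} (L : List (Vec Bool n)) (D : Subset m) → (∀ {i} → i ∈ D → toℕ i ∈ˡ gaps L) →
  ∃[ M ] M ⊆ˡ L × length M ≡ 2 * ∣ D ∣ × fromList (gaps M) ≡ D
select-gaps [] D D⊆ = select-none [] D (¬Any[] ∘ D⊆)
select-gaps (u ∷ []) D D⊆ = select-none (u ∷ []) D (¬Any[] ∘ D⊆)
select-gaps {m = m} (u ∷ v ∷ L) D D⊆ with Fin.any? (λ i → i ∈? D ×-dec toℕ i ≟ δ u v)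
... | no fresh = extend-sublist (select-gaps L D skip)
  where
  skip : ∀ {i} → i ∈ D → toℕ i ∈ˡ gaps L
  skip i∈D with D⊆ i∈D
  ... | here eq = ⊥-elim (fresh (_ , i∈D , eq))
  ... | there i∈ = i∈
  extend-sublist : ∃[ M ] M ⊆ˡ L × _ → ∃[ M ] M ⊆ˡ u ∷ v ∷ L × _
  extend-sublist (M , M⊆L , rest) = M , u ∷ʳ v ∷ʳ M⊆L , rest
... | yes (i , i∈D , i≡δ) with select-gaps L (D - i) remaining
  where
  remaining : ∀ {j} → j ∈ D - i → toℕ j ∈ˡ gaps L
  remaining {j} j∈ with D⊆ (p─q⊆p D _ j∈)
  ... | there j∈L = j∈L
  ... | here j≡δ with Fin.toℕ-injective (trans j≡δ (sym i≡δ))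
  ...   | refl = ⊥-elim (x∉p-x D i j∈)
...   | M , M⊆L , length-M , gaps-M =
  u ∷ v ∷ M , refl ∷ refl ∷ M⊆L ,
  trans (cong (2 +_) length-M) (trans (sym (*-suc 2 _)) (cong (2 *_) (sym (∣p∣≡suc∣p-x∣ i∈D)))) ,
  ⊆-antisym forth back
  where
  forth : fromList (δ u v ∷ gaps M) ⊆ D
  forth j∈ with ∈-fromList⁻ (δ u v ∷ gaps M) j∈
  ... | here j≡δ = subst (_∈ D) (Fin.toℕ-injective (trans i≡δ (sym j≡δ))) i∈D
  ... | there j∈M = p─q⊆p D _ (subst (_ ∈_) gaps-M (∈-fromList⁺ (gaps M) j∈M))
  back : D ⊆ fromList (δ u v ∷ gaps M)
  back {j} j∈D with j Fin.≟ i
  ... | yes refl = ∈-fromList⁺ (δ u v ∷ gaps M) (here i≡δ)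
  ... | no j≢i = ∈-fromList⁺ (δ u v ∷ gaps M)
    (there (∈-fromList⁻ (gaps M) (subst (j ∈_) (sym gaps-M) (x∈p∧x≢y⇒x∈p-y j∈D j≢i))))

-- Order-shattering

infix 4 _∈ᵗ_
-- Here a tree is read as a family of subsets of `Fin n`, each given by its characteristic string.
_∈ᵗ_ : ∀ {n} → Subset n → Tree n → Set
[] ∈ᵗ tip b = b ≡ true
(false ∷ J) ∈ᵗ fork l r = J ∈ᵗ l
(true ∷ J) ∈ᵗ fork l r = J ∈ᵗ r

_⊔ᵗ_ _⊓ᵗ_ : ∀ {n} → Tree n → Tree n → Tree n
tip b ⊔ᵗ tip c = tip (b ∨ c)
fork l r ⊔ᵗ fork l′ r′ = fork (l ⊔ᵗ l′) (r ⊔ᵗ r′)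
tip b ⊓ᵗ tip c = tip (b ∧ c)
fork l r ⊓ᵗ fork l′ r′ = fork (l ⊓ᵗ l′) (r ⊓ᵗ r′)

∈-⊔ᵗ : ∀ {n} (J : Subset n) F G → J ∈ᵗ F ⊔ᵗ G → J ∈ᵗ F ⊎ J ∈ᵗ G
∈-⊔ᵗ [] (tip true) (tip c) eq = inj₁ eq
∈-⊔ᵗ [] (tip false) (tip c) eq = inj₂ eq
∈-⊔ᵗ (false ∷ J) (fork l r) (fork l′ r′) J∈ = ∈-⊔ᵗ J l l′ J∈
∈-⊔ᵗ (true ∷ J) (fork l r) (fork l′ r′) J∈ = ∈-⊔ᵗ J r r′ J∈

∈-⊓ᵗ : ∀ {n} (J : Subset n) F G → J ∈ᵗ F ⊓ᵗ G → J ∈ᵗ F × J ∈ᵗ G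
∈-⊓ᵗ [] (tip b) (tip c) eq = ∧-true b c eq
∈-⊓ᵗ (false ∷ J) (fork l r) (fork l′ r′) J∈ = ∈-⊓ᵗ J l l′ J∈
∈-⊓ᵗ (true ∷ J) (fork l r) (fork l′ r′) J∈ = ∈-⊓ᵗ J r r′ J∈

size-⊔ᵗ-⊓ᵗ : ∀ {n} (F G : Tree n) → size (F ⊔ᵗ G) + size (F ⊓ᵗ G) ≡ size F + size G
size-⊔ᵗ-⊓ᵗ (tip true) (tip true) = refl
size-⊔ᵗ-⊓ᵗ (tip true) (tip false) = refl
size-⊔ᵗ-⊓ᵗ (tip false) (tip true) = refl
size-⊔ᵗ-⊓ᵗ (tip false) (tip false) = refl
size-⊔ᵗ-⊓ᵗ (fork l r) (fork l′ r′) = begin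
  size (l ⊔ᵗ l′) + size (r ⊔ᵗ r′) + (size (l ⊓ᵗ l′) + size (r ⊓ᵗ r′))
    ≡⟨ interchange (size (l ⊔ᵗ l′)) (size (r ⊔ᵗ r′)) (size (l ⊓ᵗ l′)) (size (r ⊓ᵗ r′)) ⟩
  size (l ⊔ᵗ l′) + size (l ⊓ᵗ l′) + (size (r ⊔ᵗ r′) + size (r ⊓ᵗ r′))
    ≡⟨ cong₂ _+_ (size-⊔ᵗ-⊓ᵗ l l′) (size-⊔ᵗ-⊓ᵗ r r′) ⟩
  size l + size l′ + (size r + size r′)
    ≡⟨ interchange (size l) (size l′) (size r) (size r′) ⟩
  size l + size r + (size l′ + size r′) ∎
  where
  open ≡-Reasoning
  interchange : ∀ a b c d → a + b + (c + d) ≡ a + c + (b + d)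
  interchange = solve-∀

-- Order-shattering: the branchings of T at the depths in J can be taken simultaneously on all branches.
Shattered : ∀ {n} → Subset n → Tree n → Set
Shattered [] (tip b) = b ≡ true
Shattered (false ∷ J) (fork l r) = Shattered J l ⊎ Shattered J r
Shattered (true ∷ J) (fork l r) = Shattered J l × Shattered J r

-- Of the same size as T, because |F ∪ G| + |F ∩ G| = |F| + |G|.
shatteredSets : ∀ {n} → Tree n → Tree n
shatteredSets (tip b) = tip b
shatteredSets (fork l r) = fork (shatteredSets l ⊔ᵗ shatteredSets r) (shatteredSets l ⊓ᵗ shatteredSets r)

size-shatteredSets : ∀ {n} (T : Tree n) → size (shatteredSets T) ≡ size T
size-shatteredSets (tip b) = refl
size-shatteredSets (fork l r) = trans (size-⊔ᵗ-⊓ᵗ (shatteredSets l) (shatteredSets r))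
  (cong₂ _+_ (size-shatteredSets l) (size-shatteredSets r))

shatteredSets-sound : ∀ {n} (J : Subset n) T → J ∈ᵗ shatteredSets T → Shattered J T
shatteredSets-sound [] (tip b) eq = eq
shatteredSets-sound (false ∷ J) (fork l r) J∈ with ∈-⊔ᵗ J (shatteredSets l) (shatteredSets r) J∈
... | inj₁ J∈l = inj₁ (shatteredSets-sound J l J∈l)
... | inj₂ J∈r = inj₂ (shatteredSets-sound J r J∈r)
shatteredSets-sound (true ∷ J) (fork l r) J∈ with ∈-⊓ᵗ J (shatteredSets l) (shatteredSets r) J∈
... | J∈l , J∈r = shatteredSets-sound J l J∈l , shatteredSets-sound J r J∈r

shattered-leaf : ∀ {n} (J : Subset n) T → Shattered J T → ∃[ u ] u ∷ [] ⊆ˡ leaves T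
shattered-leaf [] (tip true) refl = [] , refl ∷ []
shattered-leaf (false ∷ J) (fork l r) (inj₁ sh) with shattered-leaf J l sh
... | u , u∈ = false ∷ u , Sublist.++⁺ (Sublist.map⁺ (false ∷_) u∈) (minimum _)
shattered-leaf (false ∷ J) (fork l r) (inj₂ sh) with shattered-leaf J r sh
... | u , u∈ = true ∷ u , Sublist.++⁺ (minimum (map (false ∷_) (leaves l))) (Sublist.map⁺ (true ∷_) u∈)
shattered-leaf (true ∷ J) (fork l r) (sh , _) with shattered-leaf J l sh
... | u , u∈ = false ∷ u , Sublist.++⁺ (Sublist.map⁺ (false ∷_) u∈) (minimum _)

shattered-nonempty : ∀ {n} (J : Subset n) T → Shattered J T → nonempty T ≡ true
shattered-nonempty J T sh = size⇒nonempty T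
  (subst (0 <_) (length-leaves T) (Sublist.length-mono-≤ (proj₂ (shattered-leaf J T sh))))

shattered⊆levels : ∀ {n} (J : Subset n) T → Shattered J T → J ⊆ levels T
shattered⊆levels [] (tip b) sh = λ ()
shattered⊆levels (false ∷ J) (fork l r) (inj₁ sh) =
  out⊆ (⊆-trans (shattered⊆levels J l sh) (p⊆p∪q (levels r)))
shattered⊆levels (false ∷ J) (fork l r) (inj₂ sh) =
  out⊆ (⊆-trans (shattered⊆levels J r sh) (q⊆p∪q (levels l) (levels r)))
shattered⊆levels (true ∷ J) (fork l r) (sh-l , sh-r)
  rewrite shattered-nonempty J l sh-l | shattered-nonempty J r sh-r =
  in⊆in (⊆-trans (shattered⊆levels J l sh-l) (p⊆p∪q (levels r)))

member : ∀ {n} (F : Tree n) → 0 < size F → ∃[ J ] J ∈ᵗ F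
member (tip true) _ = [] , refl
member (fork l r) lt with sum-positive (size l) lt
... | inj₁ l>0 = let J , J∈ = member l l>0 in false ∷ J , J∈
... | inj₂ r>0 = let J , J∈ = member r r>0 in true ∷ J , J∈

-- At most `suc ∣ E ∣ ^ h` subsets of `E` have fewer than `h` elements. The induction separates the
-- members without the first element from those with it.
large-member : ∀ {n} h (F : Tree n) (E : Subset n) → (∀ {J} → J ∈ᵗ F → J ⊆ E) →
  suc ∣ E ∣ ^ h < size F → ∃[ J ] J ∈ᵗ F × h ≤ ∣ J ∣
large-member zero F E _ big = let J , J∈ = member F (≤-<-trans z≤n big) in J , J∈ , z≤n
large-member (suc h) (tip true) [] _ big = ⊥-elim (<⇒≱ big (m^n>0 1 (suc h)))
large-member (suc h) (tip false) [] _ ()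
large-member (suc h) (fork l r) (true ∷ E) sub big
  with split (suc ∣ E ∣ ^ suc h) (suc ∣ E ∣ ^ h) (≤-<-trans (step-bound (suc ∣ E ∣) h) big)
... | firstLarge l-big =
  let J , J∈ , h≤ = large-member (suc h) l E (λ J∈ → drop-∷-⊆ (sub {false ∷ _} J∈)) l-big
  in false ∷ J , J∈ , h≤
... | secondLarge r-big =
  let J , J∈ , h≤ = large-member (suc h) r E (λ J∈ → drop-∷-⊆ (sub {true ∷ _} J∈)) r-big
  in true ∷ J , J∈ , m≤n⇒m≤1+n h≤
-- Members on the right contain the first element, so `h` further elements suffice.
... | bothMedium _ r-big =
  let J , J∈ , h≤ = large-member h r E (λ J∈ → drop-∷-⊆ (sub {true ∷ _} J∈)) r-big
  in true ∷ J , J∈ , s≤s h≤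
-- The first element lies outside `E`, so the right side has to be empty.
large-member (suc h) (fork l r) (false ∷ E) sub big with size r ≟ 0
... | no r≢0 with member r (n≢0⇒n>0 r≢0)
...   | J , J∈ with () ← sub {true ∷ J} J∈ here
large-member (suc h) (fork l r) (false ∷ E) sub big | yes r≡0 =
  let J , J∈ , h≤ = large-member (suc h) l E (λ J∈ → drop-∷-⊆ (sub {false ∷ _} J∈))
        (subst (suc ∣ E ∣ ^ suc h <_) (trans (cong (size l +_) r≡0) (+-identityʳ _)) big)
  in false ∷ J , J∈ , h≤

-- `T` shatters at least `size T` sets, all within `levels T`; so many sets cannot all be small.
large-shattered : ∀ {n} h (T : Tree n) → suc ∣ levels T ∣ ^ h < size T → ∃[ J ] Shattered J T × h ≤ ∣ J ∣
large-shattered h T big =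
  let J , J∈ , h≤ = large-member h (shatteredSets T) (levels T)
        (λ {J} J∈ → shattered⊆levels J T (shatteredSets-sound J T J∈))
        (subst (suc ∣ levels T ∣ ^ h <_) (sym (size-shatteredSets T)) big)
  in J , shatteredSets-sound J T J∈ , h≤

-- Realising every order of depths

-- The i-th smallest element of J, continued beyond ∣ J ∣ so as to be strictly monotone.
nth : ∀ {n} → Subset n → ℕ → ℕ
nth [] i = i
nth (true ∷ J) zero = zero
nth (true ∷ J) (suc i) = suc (nth J i)
nth (false ∷ J) i = suc (nth J i)

nth-monotone : ∀ {n} (J : Subset n) → StrictlyMonotone (nth J)
nth-monotone [] lt = lt
nth-monotone (true ∷ J) {zero} (s≤s _) = s≤s z≤n
nth-monotone (true ∷ J) {suc x} (s≤s lt) = s≤s (nth-monotone J lt)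
nth-monotone (false ∷ J) lt = s≤s (nth-monotone J lt)

sublist-left : ∀ {n} (l r : Tree n) {L} → L ⊆ˡ leaves l → map (false ∷_) L ⊆ˡ leaves (fork l r)
sublist-left l r {L} sub = subst (_⊆ˡ _) (++-identityʳ (map (false ∷_) L))
  (Sublist.++⁺ (Sublist.map⁺ (false ∷_) sub) (minimum _))

sublist-right : ∀ {n} (l r : Tree n) {L} → L ⊆ˡ leaves r → map (true ∷_) L ⊆ˡ leaves (fork l r)
sublist-right l r sub = Sublist.++⁺ (minimum (map (false ∷_) (leaves l))) (Sublist.map⁺ (true ∷_) sub)

-- A leaf is taken on each side of a branching at the wanted depth; at shattered depths above it the
-- left side is followed.
place-pair : ∀ {n} (J : Subset n) T → Shattered J T → ∀ {y} → y < ∣ J ∣ →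
  ∃[ u ] ∃[ v ] u ∷ v ∷ [] ⊆ˡ leaves T × δ u v ≡ nth J y
place-pair (false ∷ J) (fork l r) (inj₁ sh) y< with place-pair J l sh y<
... | u , v , sub , eq = false ∷ u , false ∷ v , sublist-left l r sub , cong suc eq
place-pair (false ∷ J) (fork l r) (inj₂ sh) y< with place-pair J r sh y<
... | u , v , sub , eq = true ∷ u , true ∷ v , sublist-right l r sub , cong suc eq
place-pair (true ∷ J) (fork l r) (sh-l , sh-r) {zero} _
  with shattered-leaf J l sh-l | shattered-leaf J r sh-r
... | u , u∈ | v , v∈ =
  false ∷ u , true ∷ v , Sublist.++⁺ (Sublist.map⁺ (false ∷_) u∈) (Sublist.map⁺ (true ∷_) v∈) , refl
place-pair (true ∷ J) (fork l r) (sh , _) {suc y} (s≤s y<) with place-pair J l sh y<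
... | u , v , sub , eq = false ∷ u , false ∷ v , sublist-left l r sub , cong suc eq

-- With `m` pairs left, the spine takes up to `m - 1` of the smallest elements of `J`, and position
-- `y` must lie beyond these.
Placeable : ∀ {n} → Subset n → ℕ → ℕ → Set
Placeable J m y = m ≤ suc y × y < ∣ J ∣

-- Once the spine has used the least element of `J`, all positions drop by one; none is zero while
-- two pairs remain.
nth-pred : ∀ {n m} (J : Subset n) ys → All (Placeable (true ∷ J) (suc (suc m))) ys →
  map (nth (true ∷ J)) ys ≡ map suc (map (nth J) (map pred ys)) × All (Placeable J (suc m)) (map pred ys)
nth-pred J [] [] = refl , []
nth-pred J (suc y ∷ ys) ((s≤s m≤ , s≤s y<) ∷ ok) with nth-pred J ys ok
... | eq , ok′ = cong (_ ∷_) eq , (m≤ , y<) ∷ ok′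
nth-pred J (zero ∷ ys) ((s≤s () , _) ∷ ok)

-- The pairs are hung on a right comb, which uses up length ys - 1 elements of J above all of ys.
place : ∀ {n} (J : Subset n) T → Shattered J T → ∀ ys → All (Placeable J (length ys)) ys →
  ∃[ L ] L ⊆ˡ leaves T × gaps L ≡ map (nth J) ys × length L ≡ 2 * length ys
place J T sh [] _ = [] , minimum _ , refl , refl
place J T sh (y ∷ []) ((_ , y<) ∷ []) with place-pair J T sh y<
... | u , v , sub , eq = u ∷ v ∷ [] , sub , cong (_∷ []) eq , refl
place [] T sh (y ∷ z ∷ ys) ((_ , ()) ∷ _)
place (false ∷ J) (fork l r) (inj₁ sh) ys@(_ ∷ _ ∷ _) ok with place J l sh ys ok
... | L , sub , eq , len = map (false ∷_) L , sublist-left l r sub ,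
  trans (gaps-map false L) (trans (cong (map suc) eq) (sym (map-∘ ys))) , trans (length-map _ L) len
place (false ∷ J) (fork l r) (inj₂ sh) ys@(_ ∷ _ ∷ _) ok with place J r sh ys ok
... | L , sub , eq , len = map (true ∷_) L , sublist-right l r sub ,
  trans (gaps-map true L) (trans (cong (map suc) eq) (sym (map-∘ ys))) , trans (length-map _ L) len
place (true ∷ J) (fork l r) (sh-l , sh-r) (y ∷ z ∷ ys) ok with nth-pred J (y ∷ z ∷ ys) ok
... | eq , (_ , y<) ∷ ok′
  with place-pair J l sh-l y<
     | place J r sh-r (map pred (z ∷ ys)) (subst (λ m → All (Placeable J m) (map pred (z ∷ ys)))
         (cong suc (sym (length-map pred ys))) ok′)
... | u , v , sub-l , eq-l | L , sub-r , eq-r , len =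
  -- The first pair goes left of this branching and all later ones right, so no pair straddles it.
  (false ∷ u) ∷ (false ∷ v) ∷ map (true ∷_) L ,
  Sublist.++⁺ (Sublist.map⁺ (false ∷_) sub-l) (Sublist.map⁺ (true ∷_) sub-r) ,
  trans (cong₂ _∷_ (cong suc eq-l) (trans (gaps-map true L) (cong (map suc) eq-r))) (sym eq) ,
  trans (cong (2 +_) (trans (length-map _ L) (trans len (cong (λ m → 2 * suc m) (length-map pred ys)))))
    (sym (*-suc 2 (suc (length ys))))

-- Shifting the positions by `k` leaves room for the spine below the pairs. Neither the shift nor
-- `nth J` changes the relative order, hence the code.
shattered-permutation : ∀ {n} k (J : Subset n) T → Shattered J T → 2 * k ≤ ∣ J ∣ → ∀ {m} → m < k ! →
  ∃[ L ] L ⊆ˡ leaves T × length L ≡ 2 * k × code (gaps L) ≡ m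
shattered-permutation k J T sh 2k≤ {m} m<k! with place J T sh ys ok
  where
  π = permutation k m
  ys = map (k +_) π
  length-ys : length ys ≡ k
  length-ys = trans (length-map _ π) (permutation-length k m)
  ok : All (Placeable J (length ys)) ys
  ok = All.map⁺ (All.map
    (λ {y} y<k → ≤-trans (≤-reflexive length-ys) (m≤n⇒m≤1+n (m≤m+n k y)) ,
      <-≤-trans (+-monoʳ-< k y<k) (≤-trans (≤-reflexive (cong (k +_) (sym (+-identityʳ k)))) 2k≤))
    (permutation-< k m))
... | L , sub , eq , len = L , sub ,
  trans len (cong (2 *_) (trans (length-map _ (permutation k m)) (permutation-length k m))) ,
  (begin
    code (gaps L)                                 ≡⟨ cong code eq ⟩
    code (map (nth J) (map (k +_) (permutation k m)))  ≡⟨ code-map (nth-monotone J) (map (k +_) (permutation k m)) ⟩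
    code (map (k +_) (permutation k m))           ≡⟨ code-map (+-monoʳ-< k) (permutation k m) ⟩
    code (permutation k m)                        ≡⟨ code-permutation k m<k! ⟩
    m ∎)
  where open ≡-Reasoning

-- The step-up for (c)

module _ {k n q p t s : ℕ} (big : (t + t) ^ (2 * k) < s) (χ : Colouring k n (suc q)) where

  -- If two of `k` depths coincide, `fromList ds` has fewer than `k` elements and `extend` takes its
  -- default.
  gapColour : List ℕ → Fin (suc q * suc p)
  gapColour ds = combine (extend χ (fromList ds)) (truncate (code ds))

  step-up-product : suc p ≤ k ! →
    (∀ (colour : Tree n → Fin (suc q * suc p)) → TreeUnavoidable (2 * k) s (suc p) colour) →
    ∃[ S ] ∣ S ∣ ≡ t × FewColours (suc p) χ S
  step-up-product p<k! unavoidable = conclude (unavoidable (gapColour ∘ gaps ∘ leaves))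
    where
    conclude : TreeUnavoidable (2 * k) s (suc p) (gapColour ∘ gaps ∘ leaves) →
      ∃[ S ] ∣ S ∣ ≡ t × FewColours (suc p) χ S
    conclude (T , refl , D , D<p , colours) = by-levels (t + t ≤? ∣ levels T ∣)
      where
      coloured : ∀ {L} → L ⊆ˡ leaves T → length L ≡ 2 * k → gapColour (gaps L) ∈ D
      coloured sub len with subtree T sub
      ... | T′ , T′⊑ , refl = colours T′⊑ (trans (sym (length-leaves T′)) len)

      from-gaps : ∀ L → L ⊆ˡ leaves T → t ≤ ∣ fromList {n} (gaps L) ∣ →
        ∃[ S ] ∣ S ∣ ≡ t × FewColours (suc p) χ S
      from-gaps L sub t≤ with subset-of-size t (fromList (gaps L)) t≤
      ... | S , S⊆ , ∣S∣≡t = S , ∣S∣≡t , few-colours χ S D (proj₁ ∘ remQuot (suc p)) D<p covers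
        where
        covers : ∀ e → proj₁ e ⊆ S → ∃[ j ] j ∈ D × proj₁ (remQuot (suc p) j) ≡ χ e
        covers e@(X , ∣X∣≡k) X⊆S with select-gaps L X (λ i∈ → ∈-fromList⁻ (gaps L) (S⊆ (X⊆S i∈)))
        ... | M , M⊆L , len , refl = _ , coloured (⊆ˡ-trans M⊆L sub) (trans len (cong (2 *_) ∣X∣≡k)) ,
          trans
            (cong proj₁ (Fin.remQuot-combine (extend χ (fromList (gaps M))) (truncate {p} (code (gaps M)))))
            (extend-edge χ e)

      odd even : Subset n
      odd = fromList (gaps (leaves T))
      even = fromList (gaps (drop 1 (leaves T)))

      by-levels : Dec (t + t ≤ ∣ levels T ∣) → ∃[ S ] ∣ S ∣ ≡ t × FewColours (suc p) χ S
      by-levels (yes many) with t ≤? ∣ odd ∣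
      ... | yes t≤ = from-gaps (leaves T) ⊆ˡ-refl t≤
      -- One of the two parities accounts for at least half of the depths.
      ... | no t≰ = from-gaps (drop 1 (leaves T)) (Sublist.drop⁺ (z≤n {1}) ⊆ˡ-refl) (+-cancelˡ-≤ t _ _ (begin
        t + t
          ≤⟨ many ⟩
        ∣ levels T ∣
          ≤⟨ p⊆q⇒∣p∣≤∣q∣ (levels⊆gaps T) ⟩
        ∣ odd ∪ even ∣
          ≤⟨ union-≤ odd even ⟩
        ∣ odd ∣ + ∣ even ∣
          ≤⟨ +-monoˡ-≤ ∣ even ∣ (<⇒≤ (≰⇒> t≰)) ⟩
        t + ∣ even ∣ ∎))
        where open ≤-Reasoning
      -- Fewer than `t + t` depths occur, so `suc ∣ levels T ∣ ^ (2 * k)` is below the size of `T`.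
      by-levels (no few) with large-shattered (2 * k) T (≤-<-trans (^-monoˡ-≤ (2 * k) (≰⇒> few)) big)
      ... | J , sh , 2k≤ = ⊥-elim (<⇒≱ D<p (surjective-≤ D (proj₂ ∘ remQuot {suc q} (suc p)) onto))
        where
        onto : ∀ i → ∃[ j ] j ∈ D × proj₂ (remQuot {suc q} (suc p) j) ≡ i
        onto i with shattered-permutation k J T sh 2k≤ (<-≤-trans (Fin.toℕ<n i) p<k!)
        ... | L , sub , len , code≡ = _ , coloured sub len , (begin
          proj₂ (remQuot {suc q} (suc p) (gapColour (gaps L)))
            ≡⟨ cong proj₂ (Fin.remQuot-combine (extend χ (fromList (gaps L))) (truncate {p} (code (gaps L)))) ⟩
          truncate (code (gaps L))
            ≡⟨ cong truncate code≡ ⟩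
          truncate (toℕ i)
            ≡⟨ truncate-toℕ i ⟩
          i ∎)
          where open ≡-Reasoning

-- The exponent and the conclusion

rational : ℚ → ℝ
rational c = record
  { lower = ℚ._< c
  ; upper = c ℚ.<_
  ; lower-inhabited =
    c ℚ.- 1ℚ , subst (c ℚ.- 1ℚ ℚ.<_) (ℚ.+-identityʳ c) (ℚ.+-monoʳ-< c (ℚ.negative⁻¹ (ℚ.- 1ℚ)))
  ; upper-inhabited = c ℚ.+ 1ℚ , subst (ℚ._< c ℚ.+ 1ℚ) (ℚ.+-identityʳ c) (ℚ.+-monoʳ-< c (ℚ.positive⁻¹ 1ℚ))
  ; lower-rounded = λ r → mk⇔ ℚ.<-dense (λ (s , r<s , s<c) → ℚ.<-trans r<s s<c)
  ; upper-rounded = λ r → mk⇔ (λ c<r → let s , c<s , s<r = ℚ.<-dense c<r in s , s<r , c<s)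
      (λ (s , s<r , c<s) → ℚ.<-trans c<s s<r)
  ; disjoint = λ r (r<c , c<r) → ℚ.<-asym r<c c<r
  ; located = locate
  }
  where
  locate : ∀ r s → r ℚ.< s → _
  locate r s r<s with r ℚ.<? c
  ... | yes r<c = inj₁ r<c
  ... | no r≮c = inj₂ (ℚ.≤-<-trans (ℚ.≮⇒≥ r≮c) r<s)

natural : ℕ → ℝ
natural a = rational (ℤ.+ a ℚ./ 1)

1≤natural : ∀ a → 1 ≤ a → 1ℚ ≤ℝ natural a
1≤natural (suc a) _ a<1 = ℚ.<-irrefl refl (ℚ.<-≤-trans a<1 (ℚ.toℚᵘ-cancel-≤
  (ℚᵘ.≤-respʳ-≃ (ℚᵘ.≃-sym (ℚ.toℚᵘ-fromℚᵘ (ℚᵘ.mkℚᵘ (ℤ.+ suc a) 0)))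
    (ℚᵘ.*≤* (ℤ.+≤+ (s≤s z≤n))))))

ceil-power-≥ : ∀ a {t s} → IsCeilPower t (natural a) s → t ^ a ≤ s
ceil-power-≥ a {t} {s} (power , _) = subst (t ^ a ≤_) (*-identityʳ s) (power a 1 (ℚ.<-irrefl refl))

power-bound : ∀ {t} k → 2 < t → 0 < k → (t + t) ^ k < t ^ (2 * k)
power-bound {t} (suc k) 2<t _ =
  subst ((t + t) ^ suc k <_) (^-*-assoc t 2 (suc k)) (^-monoˡ-< (suc k) (begin-strict
  t + t       ≡⟨ cong (t +_) (+-identityʳ t) ⟨
  2 * t       <⟨ *-monoˡ-< t {{>-nonZero (<-trans (s≤s z≤n) 2<t)}} 2<t ⟩
  t * t       ≡⟨ cong (t *_) (*-identityʳ t) ⟨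
  t ^ 2       ∎))
  where open ≤-Reasoning

-- Minimality applies as `n` is positive: the empty vertex set has no subset of size `t > 0`.
Unavoidable-lower : ∀ {k t q p n} → 0 < t → IsRamsey k t (suc q) p n → ¬ Unavoidable k t (suc q) p (n ∸ 1)
Unavoidable-lower {n = suc n} t>0 (_ , least) = least n ≤-refl
Unavoidable-lower {n = zero} t>0 (unavoidable , _) with unavoidable (λ _ → zero)
... | [] , refl , _ with () ← t>0

-- If `m` were at most `2 ^ (n ∸ 1)`, the strings of length `n ∸ 1` would carry the step-up of any
-- `χ`, and `n ∸ 1` would already be unavoidable.
reduction : ∀ {k t q p n K s Q m} → 0 < t → IsRamsey k t (suc q) p n → Unavoidable K s Q p m →
  (∀ (χ : Colouring k (n ∸ 1) (suc q)) →
    (∀ (colour : Tree (n ∸ 1) → Fin Q) → TreeUnavoidable K s p colour) →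
    ∃[ S ] ∣ S ∣ ≡ t × FewColours p χ S) →
  2 ^ (n ∸ 1) < m
reduction {n = n} {m = m} t>0 ramsey unavoidable step = ≰⇒> λ m≤ → Unavoidable-lower t>0 ramsey λ χ →
  step χ λ colour → tree-unavoidable colour (subst (m ≤_) (sym (pow≡2^ (n ∸ 1))) m≤) unavoidable

theorem1p3 : ∀ (k q p : ℕ) → 3 ≤ k → 3 ≤ q → 3 ≤ p → p ≤ q →
    ∃[ c ] ∃[ t₀ ] (1ℚ ≤ℝ c) × (∀ (t : ℕ) → t₀ < t →
    (p ≤ catalan k ∸ 2 →
    ∀ m n → IsRamseyPower (k + 1) t c q p m → IsRamsey k t q p n →
    2 ^ (n ∸ 1) < m)
    × (p ≤ catalan k →
    ∀ m n → IsRamseyPower (k + 1) t c (2 * q + p) p m → IsRamsey k t q p n →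
    2 ^ (n ∸ 1) < m)
    × (p ≤ k ! →
    ∀ m n → IsRamseyPower (2 * k) t c (q * p) p m → IsRamsey k t q p n →
    2 ^ (n ∸ 1) < m))
theorem1p3 k@(suc _) (suc q) (suc (suc (suc p))) 3≤k _ (s≤s (s≤s (s≤s _))) p≤q =
  -- For (c), `2 * k` shattered depths are wanted, for which more than `(t + t) ^ (2 * k)` strings
  -- suffice; `t + t < t ^ 2` for `t > 2` turns this into the exponent 4k. The bound also serves (a)
  -- and (b), since `k ≤ 2 * k`.
  natural (2 * (2 * k)) , 2 , 1≤natural (2 * (2 * k)) (s≤s z≤n) , λ t 2<t →
  let
    t>0 = ≤-trans (s≤s z≤n) 2<t
    big : ∀ {s} → IsCeilPower t (natural (2 * (2 * k))) s → (t + t) ^ (2 * k) < s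
    big ceil = <-≤-trans (power-bound (2 * k) 2<t (s≤s z≤n)) (ceil-power-≥ (2 * (2 * k)) ceil)
  in
  (λ p≤ m n (s , ceil , unavoidable , _) ramsey → reduction t>0 ramsey unavoidable λ χ →
    step-up-same 2≤k k≤2k (big ceil) χ p≤ (s≤s⁻¹ p≤q)) ,
  (λ p≤ m n (s , ceil , unavoidable , _) ramsey → reduction t>0 ramsey unavoidable λ χ →
    step-up-fresh 2≤k k≤2k (big ceil) χ p≤) ,
  (λ p≤ m n (s , ceil , unavoidable , _) ramsey → reduction t>0 ramsey unavoidable λ χ →
    step-up-product {k = k} (big ceil) χ p≤)
  where
  2≤k : 2 ≤ k
  2≤k = ≤-trans (s≤s (s≤s z≤n)) 3≤k
  k≤2k : k ≤ 2 * k
  k≤2k = m≤m+n k _
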